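{- Let $n$ be an even natural number. Then the maximum size $r(2,\mathbb{F}_3^n)$ of a $2$-cap in $\mathbb{F}_3^n$ equals $3^{n/2}$.
   Context: $\mathbb{F}_3^n$ denotes $n$-dimensional affine space over the field with three elements. A $k$-dimensional flat is a $k$-dimensional affine subspace. For $d \in \mathbb{N}$, a subset $C \subseteq \mathbb{F}_3^n$ is a $d$-cap if, for each $k=1,\dots,d$, no $k+2$ points of $C$ lie on a $k$-dimensional flat (equivalently, every subset of $C$ of size at most $d+2$ is affinely independent). In particular, a $2$-cap is a set with no three collinear points and no four coplanar points. $r(d,\mathbb{F}_3^n)$ denotes the largest cardinality of a $d$-cap in $\mathbb{F}_3^n$. -}

module Defs where

open import Data.Nat using (ℕ; suc; _≤_; _+_)
open import Data.Fin using (Fin; zero; suc)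
open import Data.Vec using (Vec; []; _∷_; replicate; zipWith)
import Data.Vec
import Data.Product
open import Data.List using (List; []; _∷_; length)
open import Data.List.Relation.Unary.All using (All)
open import Data.List.Relation.Unary.Unique.Propositional using (Unique)
open import Data.List.Relation.Binary.Sublist.Propositional using (_⊆_)
open import Data.Product using (_×_)
open import Relation.Binary.PropositionalEquality using (_≡_)

F₃ : Set
F₃ = Fin 3

0F 1F 2F : F₃
0F = zero
1F = suc zero
2F = suc (suc zero)

_+₃_ : F₃ → F₃ → F₃
zero +₃ y = y
suc zero +₃ zero = 1F
suc zero +₃ suc zero = 2F
suc zero +₃ suc (suc zero) = 0F
suc (suc zero) +₃ zero = 2F
suc (suc zero) +₃ suc zero = 0F
suc (suc zero) +₃ suc (suc zero) = 1F

_*₃_ : F₃ → F₃ → F₃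
zero *₃ y = 0F
suc zero *₃ y = y
suc (suc zero) *₃ zero = 0F
suc (suc zero) *₃ suc zero = 2F
suc (suc zero) *₃ suc (suc zero) = 1F

Point : ℕ → Set
Point n = Vec F₃ n

_+ᵥ_ : ∀ {n} → Point n → Point n → Point n
_+ᵥ_ = zipWith _+₃_

_·ᵥ_ : ∀ {n} → F₃ → Point n → Point n
_·ᵥ_ c = Data.Vec.map (c *₃_)

0ᵥ : ∀ {n} → Point n
0ᵥ = replicate _ 0F

coeffSum : ∀ {m} → Vec F₃ m → F₃
coeffSum [] = 0F
coeffSum (c ∷ cs) = c +₃ coeffSum cs

linComb : ∀ {n} (ps : List (Point n)) → Vec F₃ (length ps) → Point n
linComb [] [] = 0ᵥ
linComb (p ∷ ps) (c ∷ cs) = (c ·ᵥ p) +ᵥ linComb ps cs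

AffinelyIndependent : ∀ {n} → List (Point n) → Set
AffinelyIndependent ps =
  (cs : Vec F₃ (length ps)) → coeffSum cs ≡ 0F → linComb ps cs ≡ 0ᵥ →
  cs ≡ replicate _ 0F

IsCap : ℕ → (n : ℕ) → List (Point n) → Set
IsCap d n C =
  Unique C ×
  (∀ (S : List (Point n)) → S ⊆ C → length S ≤ 2 + d → AffinelyIndependent S)

IsMaxCapSize : ℕ → ℕ → ℕ → Set
IsMaxCapSize d n r =
  Data.Product.Σ (List (Point n)) (λ C → IsCap d n C × length C ≡ r) ×
  (∀ (C : List (Point n)) → IsCap d n C → length C ≤ r)

{-# OPTIONS --safe #-}
module Submission where

-- A set is a 2-cap iff it is Sidon: a + b = c + d forces {a , b} = {c , d}. The differences of
-- ordered pairs of distinct points are then distinct, so a 2-cap with m points in F₃²ᵏ satisfies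
-- m (m - 1) ≤ 9ᵏ, whence m ≤ 3ᵏ. Conversely the graph of x ↦ x² over the field with 3ᵏ elements
-- is Sidon.
--
-- That field is obtained without irreducible polynomials. Let F₃[X] act on sequences in F₃, X being
-- the shift, and let M = 3ᵏ - 1. If s is M-periodic then the quotient of F₃[X] by the annihilator of
-- s satisfies pᴹ⁺¹ = p, so every pᴹ is idempotent there. Replacing s by pᴹ s or by (1 - pᴹ) s, for
-- all p of degree less than M in turn, makes every pᴹ equal to 0 or 1, so the quotient becomes a
-- domain; at every stage one of the two choices keeps the product of the X^(3ᵈ) - X with 0 < d < k
-- from annihilating s. In the final quotient X therefore has k distinct conjugates X^(3ⁱ), so no
-- nonzero polynomial of degree less than k vanishes at X, and these polynomials exhaust the
-- quotient because Y^(3ᵏ) - Y has at most 3ᵏ roots.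

open import Defs
open import Algebra.Bundles using (CommutativeRing; RawRing)
import Algebra.Solver.Ring as RingSolver
open import Algebra.Solver.Ring.AlmostCommutativeRing
  using (_-Raw-AlmostCommutative⟶_; fromCommutativeRing)
open import Data.Fin as Fin using (Fin; zero; suc; punchIn; remQuot; combine; funToFin; finToFun)
open import Data.Fin.Properties
  using (all?; _≟_; toℕ-fromℕ<; punchIn-injective; punchInᵢ≢i; combine-remQuot;
         finToFun-funToFin; injective⇒≤)
open import Data.List
  using (List; []; _∷_; length; filter; foldr; lookup; map; cartesianProductWith; allFin; applyUpTo)
open import Data.List.Membership.Propositional using (_∈_)
open import Data.List.Membership.Propositional.Properties
  using (∈-lookup; ∈-filter⁺; ∈-filter⁻; ∈-map⁻; ∈-cartesianProductWith⁺; ∈-allFin)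
import Data.List.Membership.DecPropositional as DecMembership
import Data.List.Membership.Setoid.Properties as Membership
open import Data.List.Properties using (length-++; length-applyUpTo; length-map)
open import Data.List.Relation.Binary.Sublist.Propositional using (_⊆_; []; _∷_)
  renaming (_∷ʳ_ to _∷ˢ_)
open import Data.List.Relation.Binary.Sublist.Propositional.Properties using (filter-⊆; All-resp-⊆)
open import Data.List.Relation.Unary.All as All using (All; []; _∷_)
import Data.List.Relation.Unary.All.Properties as All
open import Data.List.Relation.Unary.AllPairs as AllPairs using (AllPairs; []; _∷_)
import Data.List.Relation.Unary.AllPairs.Properties as AllPairs
open import Data.List.Relation.Unary.Any as Any using (here; there)
open import Data.List.Relation.Unary.Unique.Propositional using (Unique)
import Data.List.Relation.Unary.Unique.Propositional.Properties as Unique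
open import Data.Maybe using (Maybe) renaming (map to mapMaybe)
open import Data.Nat using (ℕ; zero; suc; _^_; _/_; _%_; _≤_; _<_; z≤n; s≤s; s≤s⁻¹; z<s)
import Data.Nat as ℕ
open import Data.Nat.Divisibility using (_∣_; divides)
import Data.Nat.DivMod as ℕ
import Data.Nat.Properties as ℕ
open import Data.Product using (_×_; _,_; proj₁; proj₂; ∃-syntax; uncurry)
open import Data.Sum as Sum using (_⊎_; inj₁; inj₂; [_,_]′)
open import Data.Vec as Vec using (Vec; []; _∷_; replicate; _∷ʳ_; initLast)
import Data.Vec.Properties as Vec
open import Function using (_∘_; id)
open import Level using (0ℓ)
import Relation.Binary.Reasoning.Setoid as SetoidReasoning
open import Relation.Binary.PropositionalEquality
  using (_≡_; _≢_; _≗_; refl; cong; cong₂; sym; trans; subst; module ≡-Reasoning)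
  renaming (setoid to ≡-setoid)
open import Relation.Nullary using (¬_; contradiction; Dec; yes; no)
open import Relation.Nullary.Decidable using (toWitness; map′; _→-dec_; dec⇒maybe)

-- Arithmetic of F₃ⁿ

+₃-assoc : ∀ a b c → (a +₃ b) +₃ c ≡ a +₃ (b +₃ c)
+₃-assoc = toWitness {a? = all? λ a → all? λ b → all? λ c → _ ≟ _} _

+₃-comm : ∀ a b → a +₃ b ≡ b +₃ a
+₃-comm = toWitness {a? = all? λ a → all? λ b → _ ≟ _} _

+₃-identityʳ : ∀ a → a +₃ 0F ≡ a
+₃-identityʳ = toWitness {a? = all? λ a → _ ≟ _} _

+₃-inverseʳ : ∀ a → a +₃ (2F *₃ a) ≡ 0F
+₃-inverseʳ = toWitness {a? = all? λ a → _ ≟ _} _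

*₃-assoc : ∀ a b c → (a *₃ b) *₃ c ≡ a *₃ (b *₃ c)
*₃-assoc = toWitness {a? = all? λ a → all? λ b → all? λ c → _ ≟ _} _

*₃-comm : ∀ a b → a *₃ b ≡ b *₃ a
*₃-comm = toWitness {a? = all? λ a → all? λ b → _ ≟ _} _

*₃-distribˡ-+₃ : ∀ a b c → a *₃ (b +₃ c) ≡ (a *₃ b) +₃ (a *₃ c)
*₃-distribˡ-+₃ = toWitness {a? = all? λ a → all? λ b → all? λ c → _ ≟ _} _

*₃-distribʳ-+₃ : ∀ a b c → (b +₃ c) *₃ a ≡ (b *₃ a) +₃ (c *₃ a)
*₃-distribʳ-+₃ = toWitness {a? = all? λ a → all? λ b → all? λ c → _ ≟ _} _

*₃-zeroʳ : ∀ a → a *₃ 0F ≡ 0F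
*₃-zeroʳ = toWitness {a? = all? λ a → _ ≟ _} _

+₃-medial : ∀ a b c d → (a +₃ b) +₃ (c +₃ d) ≡ (a +₃ c) +₃ (b +₃ d)
+₃-medial = toWitness {a? = all? λ a → all? λ b → all? λ c → all? λ d → _ ≟ _} _

_≟ᵥ_ : ∀ {n} (v w : Point n) → Dec (v ≡ w)
_≟ᵥ_ = Vec.≡-dec _≟_

+ᵥ-assoc : ∀ {n} (a b c : Point n) → (a +ᵥ b) +ᵥ c ≡ a +ᵥ (b +ᵥ c)
+ᵥ-assoc = Vec.zipWith-assoc +₃-assoc

+ᵥ-comm : ∀ {n} (a b : Point n) → a +ᵥ b ≡ b +ᵥ a
+ᵥ-comm = Vec.zipWith-comm +₃-comm

+ᵥ-medial : ∀ {n} (a b c d : Point n) → (a +ᵥ b) +ᵥ (c +ᵥ d) ≡ (a +ᵥ c) +ᵥ (b +ᵥ d)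
+ᵥ-medial []      []      []      []      = refl
+ᵥ-medial (a ∷ u) (b ∷ v) (c ∷ w) (d ∷ x) = cong₂ _∷_ (+₃-medial a b c d) (+ᵥ-medial u v w x)

+ᵥ-identityˡ : ∀ {n} (a : Point n) → 0ᵥ +ᵥ a ≡ a
+ᵥ-identityˡ = Vec.zipWith-identityˡ (λ _ → refl)

+ᵥ-identityʳ : ∀ {n} (a : Point n) → a +ᵥ 0ᵥ ≡ a
+ᵥ-identityʳ = Vec.zipWith-identityʳ +₃-identityʳ

·ᵥ-distribʳ : ∀ {n} x y (a : Point n) → (x +₃ y) ·ᵥ a ≡ (x ·ᵥ a) +ᵥ (y ·ᵥ a)
·ᵥ-distribʳ x y []      = refl
·ᵥ-distribʳ x y (a ∷ u) = cong₂ _∷_ (*₃-distribʳ-+₃ a x y) (·ᵥ-distribʳ x y u)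

·ᵥ-distribˡ : ∀ {n} x (a b : Point n) → x ·ᵥ (a +ᵥ b) ≡ (x ·ᵥ a) +ᵥ (x ·ᵥ b)
·ᵥ-distribˡ x []      []      = refl
·ᵥ-distribˡ x (a ∷ u) (b ∷ v) = cong₂ _∷_ (*₃-distribˡ-+₃ x a b) (·ᵥ-distribˡ x u v)

1·ᵥ : ∀ {n} (a : Point n) → 1F ·ᵥ a ≡ a
1·ᵥ = Vec.map-id

0·ᵥ : ∀ {n} (a : Point n) → 0F ·ᵥ a ≡ 0ᵥ
0·ᵥ a = Vec.map-const a 0F

·ᵥ-0ᵥ : ∀ {n} x → x ·ᵥ 0ᵥ {n} ≡ 0ᵥ
·ᵥ-0ᵥ x = trans (Vec.map-replicate _ _ _) (cong (replicate _) (*₃-zeroʳ x))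

a+d≡b+c⇒a-b-c+d≡0 : ∀ {n} (a b c d : Point n) → a +ᵥ d ≡ b +ᵥ c →
  (1F ·ᵥ a) +ᵥ ((2F ·ᵥ b) +ᵥ ((2F ·ᵥ c) +ᵥ (1F ·ᵥ d))) ≡ 0ᵥ
a+d≡b+c⇒a-b-c+d≡0 []      []      []      []      _  = refl
a+d≡b+c⇒a-b-c+d≡0 (a ∷ u) (b ∷ v) (c ∷ w) (d ∷ x) eq =
  cong₂ _∷_ (coordinate a b c d (Vec.∷-injectiveˡ eq))
    (a+d≡b+c⇒a-b-c+d≡0 u v w x (Vec.∷-injectiveʳ eq))
  where
  coordinate : ∀ a b c d → a +₃ d ≡ b +₃ c → a +₃ ((2F *₃ b) +₃ ((2F *₃ c) +₃ d)) ≡ 0F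
  coordinate = toWitness {a? = all? λ a → all? λ b → all? λ c → all? λ d → (_ ≟ _) →-dec (_ ≟ _)} _

a-b≡c-d⇒a+d≡b+c : ∀ {n} (a b c d : Point n) → a +ᵥ (2F ·ᵥ b) ≡ c +ᵥ (2F ·ᵥ d) → a +ᵥ d ≡ b +ᵥ c
a-b≡c-d⇒a+d≡b+c []      []      []      []      _  = refl
a-b≡c-d⇒a+d≡b+c (a ∷ u) (b ∷ v) (c ∷ w) (d ∷ x) eq =
  cong₂ _∷_ (coordinate a b c d (Vec.∷-injectiveˡ eq))
    (a-b≡c-d⇒a+d≡b+c u v w x (Vec.∷-injectiveʳ eq))
  where
  coordinate : ∀ a b c d → a +₃ (2F *₃ b) ≡ c +₃ (2F *₃ d) → a +₃ d ≡ b +₃ c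
  coordinate = toWitness {a? = all? λ a → all? λ b → all? λ c → all? λ d → (_ ≟ _) →-dec (_ ≟ _)} _

a+d≡b+a⇒d≡b : ∀ {n} (a b d : Point n) → a +ᵥ d ≡ b +ᵥ a → d ≡ b
a+d≡b+a⇒d≡b []      []      []      _  = refl
a+d≡b+a⇒d≡b (a ∷ u) (b ∷ v) (d ∷ x) eq =
  cong₂ _∷_ (coordinate a b d (Vec.∷-injectiveˡ eq)) (a+d≡b+a⇒d≡b u v x (Vec.∷-injectiveʳ eq))
  where
  coordinate : ∀ a b d → a +₃ d ≡ b +₃ a → d ≡ b
  coordinate = toWitness {a? = all? λ a → all? λ b → all? λ d → (_ ≟ _) →-dec (_ ≟ _)} _

-- In characteristic 3, -c = c + c. This turns three collinear points into an instance of the Sidon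
-- equation. The inner `0ᵥ` is the one that `total` leaves at the end of a sum.
a+b+c≡0⇒a+b≡c+c : ∀ {n} (a b c : Point n) → a +ᵥ (b +ᵥ (c +ᵥ 0ᵥ)) ≡ 0ᵥ → a +ᵥ b ≡ c +ᵥ c
a+b+c≡0⇒a+b≡c+c []      []      []      _  = refl
a+b+c≡0⇒a+b≡c+c (a ∷ u) (b ∷ v) (c ∷ w) eq =
  cong₂ _∷_ (coordinate a b c (Vec.∷-injectiveˡ eq)) (a+b+c≡0⇒a+b≡c+c u v w (Vec.∷-injectiveʳ eq))
  where
  coordinate : ∀ a b c → a +₃ (b +₃ (c +₃ 0F)) ≡ 0F → a +₃ b ≡ c +₃ c
  coordinate = toWitness {a? = all? λ a → all? λ b → all? λ c → (_ ≟ _) →-dec (_ ≟ _)} _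

a-b≡0⇒a≡b₃ : ∀ a b → a +₃ (2F *₃ b) ≡ 0F → a ≡ b
a-b≡0⇒a≡b₃ = toWitness {a? = all? λ a → all? λ b → (_ ≟ _) →-dec (_ ≟ _)} _

a-b≡0⇒a≡b : ∀ {n} (a b : Point n) → a +ᵥ (2F ·ᵥ b) ≡ 0ᵥ → a ≡ b
a-b≡0⇒a≡b []      []      _  = refl
a-b≡0⇒a≡b (a ∷ u) (b ∷ v) eq =
  cong₂ _∷_ (a-b≡0⇒a≡b₃ a b (Vec.∷-injectiveˡ eq)) (a-b≡0⇒a≡b u v (Vec.∷-injectiveʳ eq))

-- Counting points and lists without repetition

length-cartesianProductWith : ∀ {A B C : Set} (f : A → B → C) xs ys →
  length (cartesianProductWith f xs ys) ≡ length xs ℕ.* length ys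
length-cartesianProductWith f []       ys = refl
length-cartesianProductWith f (x ∷ xs) ys =
  trans (length-++ (map (f x) ys))
    (cong₂ ℕ._+_ (length-map (f x) ys) (length-cartesianProductWith f xs ys))

allPoints : ∀ n → List (Point n)
allPoints zero    = [] ∷ []
allPoints (suc n) = cartesianProductWith _∷_ (allFin 3) (allPoints n)

∈-allPoints : ∀ {n} (v : Point n) → v ∈ allPoints n
∈-allPoints []      = here refl
∈-allPoints (c ∷ v) = ∈-cartesianProductWith⁺ _∷_ (∈-allFin c) (∈-allPoints v)

allPoints-unique : ∀ n → Unique (allPoints n)
allPoints-unique zero    = [] ∷ []
allPoints-unique (suc n) =
  Unique.cartesianProductWith⁺ _∷_ Vec.∷-injective (Unique.allFin⁺ 3) (allPoints-unique n)

length-allPoints : ∀ n → length (allPoints n) ≡ 3 ^ n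
length-allPoints zero    = refl
length-allPoints (suc n) =
  trans (length-cartesianProductWith _∷_ (allFin 3) (allPoints n))
    (cong (3 ℕ.*_) (length-allPoints n))

unique-lookup-injective : ∀ {A : Set} {xs : List A} → Unique xs →
  ∀ i j → lookup xs i ≡ lookup xs j → i ≡ j
unique-lookup-injective (_ ∷ _)    zero    zero    _  = refl
unique-lookup-injective (x∉xs ∷ _) zero    (suc j) eq =
  contradiction eq (All.lookup x∉xs (∈-lookup j))
unique-lookup-injective (x∉xs ∷ _) (suc i) zero    eq =
  contradiction (sym eq) (All.lookup x∉xs (∈-lookup i))
unique-lookup-injective (_ ∷ u)    (suc i) (suc j) eq = cong suc (unique-lookup-injective u i j eq)

unique-length-≤ : ∀ {A : Set} {xs ys : List A} → Unique xs → (∀ {x} → x ∈ xs → x ∈ ys) →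
  length xs ≤ length ys
unique-length-≤ {A} {xs} {ys} unique sub = injective⇒≤ {f = Any.index ∘ position} λ {i} {j} eq →
  unique-lookup-injective unique i j
    (Membership.index-injective (≡-setoid A) (position i) (position j) eq)
  where
  position : ∀ i → lookup xs i ∈ ys
  position i = sub (∈-lookup i)

-- Commutative F₃-algebras

F₃-rawRing : RawRing 0ℓ 0ℓ
F₃-rawRing = record
  { _≈_ = _≡_ ; _+_ = _+₃_ ; _*_ = _*₃_ ; -_ = 2F *₃_ ; 0# = 0F ; 1# = 1F }

module F₃-Algebra
  (R : CommutativeRing 0ℓ 0ℓ)
  (structureMap : F₃-rawRing -Raw-AlmostCommutative⟶ fromCommutativeRing R)
  where

  open CommutativeRing R renaming (refl to ≈-refl; sym to ≈-sym; trans to ≈-trans) public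
  open import Algebra.Properties.CommutativeSemiring.Exp commutativeSemiring public
    renaming (_^_ to _⋆_)
  open _-Raw-AlmostCommutative⟶_ structureMap public
    using (+-homo; *-homo; 0-homo)
    renaming (⟦_⟧ to ι)
  open SetoidReasoning setoid

  ι-≟ : ∀ a b → Maybe (ι a ≈ ι b)
  ι-≟ a b = mapMaybe (reflexive ∘ cong ι) (dec⇒maybe (a ≟ b))

  open RingSolver F₃-rawRing (fromCommutativeRing R) structureMap ι-≟ public
    using (solve; _:=_; _:+_; _:*_; _:-_; _:^_; con)

  NoZeroDivisors : Set
  NoZeroDivisors = ∀ {x y} → x * y ≈ 0# → x ≈ 0# ⊎ y ≈ 0#

  -≈0⇒≈ : ∀ {x y} → x - y ≈ 0# → x ≈ y
  -≈0⇒≈ {x} {y} eq = begin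
    x             ≈⟨ solve 2 (λ x y → x := (x :- y) :+ y) ≈-refl x y ⟩
    (x - y) + y   ≈⟨ +-congʳ eq ⟩
    0# + y        ≈⟨ +-identityˡ y ⟩
    y             ∎

  -- The solver computes with coefficients in F₃, so the mixed terms of (x + y)³, which carry a
  -- factor 3, disappear. Iterating the cube gives the 3ᵏ-th power.
  frobenius-+ : ∀ k x y → (x + y) ⋆ (3 ^ k) ≈ x ⋆ (3 ^ k) + y ⋆ (3 ^ k)
  frobenius-+ zero x y = distribʳ 1# x y
  frobenius-+ (suc k) x y = begin
    (x + y) ⋆ (3 ^ suc k)                  ≈⟨ ^-assocʳ (x + y) 3 (3 ^ k) ⟨
    ((x + y) ⋆ 3) ⋆ (3 ^ k)
      ≈⟨ ^-congˡ (3 ^ k) (solve 2 (λ x y → (x :+ y) :^ 3 := x :^ 3 :+ y :^ 3) ≈-refl x y) ⟩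
    (x ⋆ 3 + y ⋆ 3) ⋆ (3 ^ k)              ≈⟨ frobenius-+ k _ _ ⟩
    (x ⋆ 3) ⋆ (3 ^ k) + (y ⋆ 3) ⋆ (3 ^ k)
      ≈⟨ +-cong (^-assocʳ x 3 (3 ^ k)) (^-assocʳ y 3 (3 ^ k)) ⟩
    x ⋆ (3 ^ suc k) + y ⋆ (3 ^ suc k)      ∎

  -- (x - z)(x - w) vanishes because z and w have the same sum and product as x and y.
  squares-determine-summands : NoZeroDivisors → ∀ {x y z w} →
    x + y ≈ z + w → x * x + y * y ≈ z * z + w * w → x ≈ z ⊎ x ≈ w
  squares-determine-summands zero-product {x} {y} {z} {w} sum squares =
    [ inj₁ ∘ -≈0⇒≈ , inj₂ ∘ -≈0⇒≈ ]′ (zero-product (begin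
      (x - z) * (x - w)
        ≈⟨ solve 3 (λ x z w → (x :- z) :* (x :- w) := x :* x :- x :* (z :+ w) :+ z :* w)
                 ≈-refl x z w ⟩
      x * x - x * (z + w) + z * w  ≈⟨ +-cong (+-congˡ (-‿cong (*-congˡ sum))) product ⟨
      x * x - x * (x + y) + x * y
        ≈⟨ solve 2 (λ x y → x :* x :- x :* (x :+ y) :+ x :* y := con 0F) ≈-refl x y ⟩
      ι 0F  ≈⟨ 0-homo ⟩
      0# ∎))
    where
    -- The factor 1 / 2 is -1 in characteristic 3.
    polarization : ∀ x y → x * y ≈ (x * x + y * y) - (x + y) * (x + y)
    polarization = solve 2 (λ x y → x :* y := (x :* x :+ y :* y) :- (x :+ y) :* (x :+ y)) ≈-refl

    product : x * y ≈ z * w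
    product = begin
      x * y                                ≈⟨ polarization x y ⟩
      (x * x + y * y) - (x + y) * (x + y)  ≈⟨ +-cong squares (-‿cong (*-cong sum sum)) ⟩
      (z * z + w * w) - (z + w) * (z + w)  ≈⟨ polarization z w ⟨
      z * w                                ∎

  -- Roots of polynomials over a domain

  eval : List Carrier → Carrier → Carrier
  eval []       x = 0#
  eval (c ∷ cs) x = c + x * eval cs x

  -- Synthetic division by X - r: the partial Horner values at r are the coefficients of the
  -- quotient, and the last of these values is the remainder.
  quot : Carrier → List Carrier → List Carrier
  quot r []               = []
  quot r (c ∷ [])         = []
  quot r (c ∷ cs@(_ ∷ _)) = eval cs r ∷ quot r cs

  c+x*0≈c : ∀ c x → c + x * 0# ≈ c
  c+x*0≈c c x = ≈-trans (+-congˡ (zeroʳ x)) (+-identityʳ c)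

  eval-quot : ∀ r cs x → eval cs x ≈ eval cs r + (x - r) * eval (quot r cs) x
  eval-quot r [] x = ≈-sym (c+x*0≈c _ _)
  eval-quot r (c ∷ []) x =
    ≈-trans (c+x*0≈c c x) (≈-trans (≈-sym (c+x*0≈c c r)) (≈-sym (c+x*0≈c _ _)))
  eval-quot r (c ∷ cs@(_ ∷ _)) x = begin
    c + x * eval cs x
      ≈⟨ +-congˡ (*-congˡ (eval-quot r cs x)) ⟩
    c + x * (eval cs r + (x - r) * eval (quot r cs) x)
      ≈⟨ solve 5 (λ c x r e q → c :+ x :* (e :+ (x :- r) :* q) :=
                                (c :+ r :* e) :+ (x :- r) :* (e :+ x :* q))
               ≈-refl c x r (eval cs r) (eval (quot r cs) x) ⟩
    (c + r * eval cs r) + (x - r) * (eval cs r + x * eval (quot r cs) x) ∎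

  eval-zeros : ∀ {cs} → All (_≈ 0#) cs → ∀ c x → c + x * eval cs x ≈ c
  eval-zeros {[]}     []       c x = c+x*0≈c c x
  eval-zeros {d ∷ cs} (p ∷ ps) c x =
    ≈-trans (+-congˡ (*-congˡ (≈-trans (eval-zeros ps d x) p))) (c+x*0≈c c x)

  -- Read from the leading end: once the later coefficients are known to vanish, the Horner value at
  -- r is just the coefficient itself.
  quot-zeros : ∀ r c cs → All (_≈ 0#) (quot r (c ∷ cs)) → All (_≈ 0#) cs
  quot-zeros r c []       _        = []
  quot-zeros r c (d ∷ ds) (p ∷ ps) = ≈-trans (≈-sym (eval-zeros ds≈0 d r)) p ∷ ds≈0
    where
    ds≈0 : All (_≈ 0#) ds
    ds≈0 = quot-zeros r d ds ps

  length-quot : ∀ r c cs → length (quot r (c ∷ cs)) ≡ length cs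
  length-quot r c []       = refl
  length-quot r c (d ∷ ds) = cong suc (length-quot r d ds)

  -- Dividing by X - r for the first root r leaves a quotient that vanishes at all other roots, so
  -- induction applies to it. Bounding the length of the coefficient list instead of a degree avoids
  -- any search for a nonzero leading coefficient.
  many-roots⇒zero : NoZeroDivisors → ∀ cs rs → length cs ≤ length rs → AllPairs _≉_ rs →
                    All (λ r → eval cs r ≈ 0#) rs → All (_≈ 0#) cs
  many-roots⇒zero zero-product [] rs _ _ _ = []
  many-roots⇒zero zero-product (c ∷ cs) (r ∷ rs) (s≤s len) (r≉rs ∷ distinct) (root ∷ roots) =
    ≈-trans (≈-sym (eval-zeros cs≈0 c r)) root ∷ cs≈0
    where
    q : Carrier → Carrier
    q = eval (quot r (c ∷ cs))

    quotient-root : ∀ {x} → r ≉ x → eval (c ∷ cs) x ≈ 0# → q x ≈ 0#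
    quotient-root {x} r≉x eq =
      [ (λ x-r≈0 → contradiction (≈-sym (-≈0⇒≈ x-r≈0)) r≉x) , id ]′ (zero-product (begin
        (x - r) * q x                    ≈⟨ +-identityˡ _ ⟨
        0# + (x - r) * q x               ≈⟨ +-congʳ root ⟨
        eval (c ∷ cs) r + (x - r) * q x  ≈⟨ eval-quot r (c ∷ cs) x ⟨
        eval (c ∷ cs) x                  ≈⟨ eq ⟩
        0#                               ∎))

    cs≈0 : All (_≈ 0#) cs
    cs≈0 = quot-zeros r c cs
      (many-roots⇒zero zero-product (quot r (c ∷ cs)) rs
        (ℕ.≤-trans (ℕ.≤-reflexive (length-quot r c cs)) len) distinct
        (All.zipWith (λ (r≉x , eq) → quotient-root r≉x eq) (r≉rs , roots)))

-- F₃[X] acting on sequences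

Sequence : Set
Sequence = ℕ → F₃

infixl 6 _⊕_
infixl 7 _⊛_

-- Polynomials as expressions without a normal form: the ring laws are not imposed here but hold for
-- the action on sequences, where `⊛` is composition.
data Operator : Set where
  scalar  : F₃ → Operator
  shift   : Operator
  _⊕_ _⊛_ : Operator → Operator → Operator

apply : Operator → Sequence → Sequence
apply (scalar c) s i = c *₃ s i
apply shift      s i = s (suc i)
apply (p ⊕ q)    s i = apply p s i +₃ apply q s i
apply (p ⊛ q)    s   = apply p (apply q s)

apply-cong : ∀ p {s t} → s ≗ t → apply p s ≗ apply p t
apply-cong (scalar c) eq i = cong (c *₃_) (eq i)
apply-cong shift      eq i = eq (suc i)
apply-cong (p ⊕ q)    eq i = cong₂ _+₃_ (apply-cong p eq i) (apply-cong q eq i)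
apply-cong (p ⊛ q)    eq   = apply-cong p (apply-cong q eq)

apply-+ : ∀ p s t → apply p (λ i → s i +₃ t i) ≗ λ i → apply p s i +₃ apply p t i
apply-+ (scalar c) s t i = *₃-distribˡ-+₃ c (s i) (t i)
apply-+ shift      s t i = refl
apply-+ (p ⊕ q)    s t i =
  trans (cong₂ _+₃_ (apply-+ p s t i) (apply-+ q s t i))
    (+₃-medial (apply p s i) (apply p t i) (apply q s i) (apply q t i))
apply-+ (p ⊛ q)    s t i = trans (apply-cong p (apply-+ q s t) i) (apply-+ p _ _ i)

apply-scale : ∀ p c s → apply p (λ i → c *₃ s i) ≗ λ i → c *₃ apply p s i
apply-scale (scalar d) c s i = begin
  d *₃ (c *₃ s i)  ≡⟨ *₃-assoc d c (s i) ⟨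
  (d *₃ c) *₃ s i  ≡⟨ cong (_*₃ s i) (*₃-comm d c) ⟩
  (c *₃ d) *₃ s i  ≡⟨ *₃-assoc c d (s i) ⟩
  c *₃ (d *₃ s i)  ∎
  where open ≡-Reasoning
apply-scale shift      c s i = refl
apply-scale (p ⊕ q)    c s i =
  trans (cong₂ _+₃_ (apply-scale p c s i) (apply-scale q c s i)) (sym (*₃-distribˡ-+₃ c _ _))
apply-scale (p ⊛ q)    c s i = trans (apply-cong p (apply-scale q c s) i) (apply-scale p c _ i)

apply-shift : ∀ p s → apply p (s ∘ suc) ≗ apply p s ∘ suc
apply-shift (scalar c) s i = refl
apply-shift shift      s i = refl
apply-shift (p ⊕ q)    s i = cong₂ _+₃_ (apply-shift p s i) (apply-shift q s i)
apply-shift (p ⊛ q)    s i = trans (apply-cong p (apply-shift q s) i) (apply-shift p _ i)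

-- Induction on the left operator: scalars commute with `q` because `q` is linear, the shift because
-- `q` is translation-invariant.
apply-comm : ∀ p q s → apply p (apply q s) ≗ apply q (apply p s)
apply-comm (scalar c) q s i = sym (apply-scale q c s i)
apply-comm shift      q s i = sym (apply-shift q s i)
apply-comm (p ⊕ p′)   q s i =
  trans (cong₂ _+₃_ (apply-comm p q s i) (apply-comm p′ q s i)) (sym (apply-+ q _ _ i))
apply-comm (p ⊛ p′)   q s i =
  trans (apply-cong p (apply-comm p′ q s) i) (apply-comm p q _ i)

-- A record, so that unification can recover p, s and q.
infix 4 _≈[_]_
record _≈[_]_ (p : Operator) (s : Sequence) (q : Operator) : Set where
  constructor agree
  field agreement : apply p s ≗ apply q s
open _≈[_]_

-- The quotient of F₃[X] by the annihilator of s, where X acts as the shift.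
quotientRing : Sequence → CommutativeRing 0ℓ 0ℓ
quotientRing s = record
  { _≈_ = _≈[ s ]_
  ; _+_ = _⊕_
  ; _*_ = _⊛_
  ; -_ = scalar 2F ⊛_
  ; 0# = scalar 0F
  ; 1# = scalar 1F
  ; isCommutativeRing = record
    { isRing = record
      { +-isAbelianGroup = record
        { isGroup = record
          { isMonoid = record
            { isSemigroup = record
              { isMagma = record
                { isEquivalence = record
                  { refl = agree λ i → refl
                  ; sym = λ (agree e) → agree λ i → sym (e i)
                  ; trans = λ (agree e) (agree e′) → agree λ i → trans (e i) (e′ i)
                  }
                ; ∙-cong = λ (agree e) (agree e′) → agree λ i → cong₂ _+₃_ (e i) (e′ i)
                }
              ; assoc = λ p q r → agree λ i → +₃-assoc (apply p s i) (apply q s i) (apply r s i)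
              }
            ; identity = (λ p → agree λ i → refl) , λ p → agree λ i → +₃-identityʳ (apply p s i)
            }
          ; inverse = (λ p → agree λ i → trans (+₃-comm _ (apply p s i)) (+₃-inverseʳ (apply p s i)))
                    , λ p → agree λ i → +₃-inverseʳ (apply p s i)
          ; ⁻¹-cong = λ (agree e) → agree λ i → cong (2F *₃_) (e i)
          }
        ; comm = λ p q → agree λ i → +₃-comm (apply p s i) (apply q s i)
        }
      -- The agreement of `p` and `p′` is known on `s` only, not on `apply q′ s`, so the factors are
      -- swapped before it is used.
      ; *-cong = λ {p} {p′} {q} {q′} (agree e) (agree e′) → agree λ i → begin
          apply p (apply q s) i    ≡⟨ apply-cong p e′ i ⟩
          apply p (apply q′ s) i   ≡⟨ apply-comm p q′ s i ⟩
          apply q′ (apply p s) i   ≡⟨ apply-cong q′ e i ⟩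
          apply q′ (apply p′ s) i  ≡⟨ apply-comm q′ p′ s i ⟩
          apply p′ (apply q′ s) i  ∎
      ; *-assoc = λ p q r → agree λ i → refl
      ; *-identity = (λ p → agree λ i → refl) , λ p → agree (apply-comm p (scalar 1F) s)
      ; distrib = (λ p q r → agree (apply-+ p (apply q s) (apply r s)))
                , λ p q r → agree λ i → refl
      }
    ; *-comm = λ p q → agree (apply-comm p q s)
    }
  }
  where open ≡-Reasoning

scalarMap : ∀ s → F₃-rawRing -Raw-AlmostCommutative⟶ fromCommutativeRing (quotientRing s)
scalarMap s = record
  { ⟦_⟧    = scalar
  ; +-homo = λ a b → agree λ i → *₃-distribʳ-+₃ (s i) a b
  ; *-homo = λ a b → agree λ i → *₃-assoc a b (s i)
  ; -‿homo = λ a → agree λ i → *₃-assoc 2F a (s i)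
  ; 0-homo = agree λ i → refl
  ; 1-homo = agree λ i → refl
  }

module Quotient (s : Sequence) = F₃-Algebra (quotientRing s) (scalarMap s)

-- The annihilator of `apply r s` contains that of `s`, so every relation won at one stage of the
-- construction survives all later ones.
≈-apply : ∀ {s p q} r → p ≈[ s ] q → p ≈[ apply r s ] q
≈-apply {s} {p} {q} r (agree e) = agree λ i →
  trans (apply-comm p r s i) (trans (apply-cong r e i) (apply-comm r q s i))

-- Unlike Quotient._⋆_ this does not depend on a sequence, so that one power can be compared in
-- different quotients.
power : Operator → ℕ → Operator
power p zero    = scalar 1F
power p (suc k) = p ⊛ power p k

power≡⋆ : ∀ s p k → power p k ≡ Quotient._⋆_ s p k
power≡⋆ s p zero    = refl
power≡⋆ s p (suc k) = cong (p ⊛_) (power≡⋆ s p k)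

apply-shift-power : ∀ k s i → apply (power shift k) s i ≡ s (k ℕ.+ i)
apply-shift-power zero    s i = refl
apply-shift-power (suc k) s i = trans (apply-shift-power k s (suc i)) (cong s (ℕ.+-suc k i))

-- Polynomials with coefficients in F₃

horner : ∀ {m} → Vec F₃ m → Operator → Operator
horner []       x = scalar 0F
horner (c ∷ cs) x = scalar c ⊕ x ⊛ horner cs x

module _ (s : Sequence) where
  open Quotient s
  open SetoidReasoning setoid

  horner-+ : ∀ {m} (v w : Vec F₃ m) x → horner v x ⊕ horner w x ≈ horner (v +ᵥ w) x
  horner-+ []      []      x = +-identityˡ _
  horner-+ (a ∷ v) (b ∷ w) x = begin
    (scalar a ⊕ x ⊛ horner v x) ⊕ (scalar b ⊕ x ⊛ horner w x)
      ≈⟨ solve 5 (λ a b x p q → (a :+ x :* p) :+ (b :+ x :* q) := (a :+ b) :+ x :* (p :+ q))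
               ≈-refl (scalar a) (scalar b) x (horner v x) (horner w x) ⟩
    (scalar a ⊕ scalar b) ⊕ x ⊛ (horner v x ⊕ horner w x)
      ≈⟨ +-cong (≈-sym (+-homo a b)) (*-congˡ {x} (horner-+ v w x)) ⟩
    scalar (a +₃ b) ⊕ x ⊛ horner (v +ᵥ w) x ∎

  horner-· : ∀ {m} c (v : Vec F₃ m) x → scalar c ⊛ horner v x ≈ horner (c ·ᵥ v) x
  horner-· c []      x = zeroʳ (scalar c)
  horner-· c (a ∷ v) x = begin
    scalar c ⊛ (scalar a ⊕ x ⊛ horner v x)
      ≈⟨ solve 4 (λ c a x p → c :* (a :+ x :* p) := c :* a :+ x :* (c :* p))
               ≈-refl (scalar c) (scalar a) x (horner v x) ⟩
    scalar c ⊛ scalar a ⊕ x ⊛ (scalar c ⊛ horner v x)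
      ≈⟨ +-cong (≈-sym (*-homo c a)) (*-congˡ {x} (horner-· c v x)) ⟩
    scalar (c *₃ a) ⊕ x ⊛ horner (c ·ᵥ v) x ∎

  horner-0ᵥ : ∀ m x → horner (0ᵥ {m}) x ≈ 0#
  horner-0ᵥ zero    x = ≈-refl
  horner-0ᵥ (suc m) x = ≈-trans (+-congˡ {0#} (*-congˡ {x} (horner-0ᵥ m x))) (c+x*0≈c 0# x)

  -- Gives access to the leading coefficient, both for reduction by X^M = 1 and for the top term of
  -- Y^(3ⁿ) - Y.
  horner-∷ʳ : ∀ {m} (v : Vec F₃ m) c x → horner (v ∷ʳ c) x ≈ horner v x ⊕ scalar c ⊛ x ⋆ m
  horner-∷ʳ []      c x = begin
    scalar c ⊕ x ⊛ 0#   ≈⟨ c+x*0≈c _ x ⟩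
    scalar c            ≈⟨ *-identityʳ _ ⟨
    scalar c ⊛ 1#       ≈⟨ +-identityˡ _ ⟨
    0# ⊕ scalar c ⊛ 1#  ∎
  horner-∷ʳ {suc m} (a ∷ v) c x = begin
    scalar a ⊕ x ⊛ horner (v ∷ʳ c) x
      ≈⟨ +-congˡ (*-congˡ {x} (horner-∷ʳ v c x)) ⟩
    scalar a ⊕ x ⊛ (horner v x ⊕ scalar c ⊛ x ⋆ m)
      ≈⟨ solve 5 (λ a x p c y → a :+ x :* (p :+ c :* y) := (a :+ x :* p) :+ c :* (x :* y))
               ≈-refl (scalar a) x (horner v x) (scalar c) (x ⋆ m) ⟩
    (scalar a ⊕ x ⊛ horner v x) ⊕ scalar c ⊛ (x ⊛ x ⋆ m) ∎

  frobenius-scalar : ∀ k c → scalar c ⋆ (3 ^ k) ≈ scalar c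
  frobenius-scalar zero    c = *-identityʳ _
  frobenius-scalar (suc k) c = begin
    scalar c ⋆ (3 ^ suc k)      ≈⟨ ^-assocʳ (scalar c) 3 (3 ^ k) ⟨
    (scalar c ⋆ 3) ⋆ (3 ^ k)    ≈⟨ ^-congˡ (3 ^ k) (agree λ i → cube c (s i)) ⟩
    scalar c ⋆ (3 ^ k)          ≈⟨ frobenius-scalar k c ⟩
    scalar c                    ∎
    where
    cube : ∀ c x → c *₃ (c *₃ (c *₃ (1F *₃ x))) ≡ c *₃ x
    cube = toWitness {a? = all? λ c → all? λ x → _ ≟ _} _

  -- Coefficients in F₃ are fixed by the Frobenius map. Hence the conjugates x^(3ᵏ) of a root x are
  -- roots as well.
  frobenius-horner : ∀ k {m} (v : Vec F₃ m) x → horner v (x ⋆ (3 ^ k)) ≈ horner v x ⋆ (3 ^ k)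
  frobenius-horner k []      x = ≈-sym (frobenius-scalar k 0F)
  frobenius-horner k (c ∷ v) x = begin
    scalar c ⊕ x ⋆ (3 ^ k) ⊛ horner v (x ⋆ (3 ^ k))
      ≈⟨ +-cong (≈-sym (frobenius-scalar k c)) (*-congˡ {x ⋆ (3 ^ k)} (frobenius-horner k v x)) ⟩
    scalar c ⋆ (3 ^ k) ⊕ x ⋆ (3 ^ k) ⊛ horner v x ⋆ (3 ^ k)
      ≈⟨ +-congˡ (^-distrib-* x _ (3 ^ k)) ⟨
    scalar c ⋆ (3 ^ k) ⊕ (x ⊛ horner v x) ⋆ (3 ^ k)
      ≈⟨ frobenius-+ k _ _ ⟨
    horner (c ∷ v) x ⋆ (3 ^ k) ∎

  horner-zero⇒ : ¬ 1# ≈ 0# → NoZeroDivisors → ∀ {m} (v : Vec F₃ m) rs → m ≤ length rs →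
                 AllPairs _≉_ rs → All (λ r → horner v r ≈ 0#) rs → v ≡ 0ᵥ
  horner-zero⇒ 1≉0 zero-product v rs len distinct roots =
    coefficients-zero v (many-roots⇒zero zero-product (coefficients v) rs
      (ℕ.≤-trans (ℕ.≤-reflexive (length-coefficients v)) len) distinct
      (All.map (λ {r} → ≈-trans (reflexive (eval-coefficients v r))) roots))
    where
    coefficients : ∀ {m} → Vec F₃ m → List Operator
    coefficients []      = []
    coefficients (c ∷ v) = scalar c ∷ coefficients v

    length-coefficients : ∀ {m} (v : Vec F₃ m) → length (coefficients v) ≡ m
    length-coefficients []      = refl
    length-coefficients (c ∷ v) = cong suc (length-coefficients v)

    eval-coefficients : ∀ {m} (v : Vec F₃ m) x → eval (coefficients v) x ≡ horner v x
    eval-coefficients []      x = refl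
    eval-coefficients (c ∷ v) x = cong (λ p → scalar c ⊕ x ⊛ p) (eval-coefficients v x)

    scalar-zero : ∀ c → scalar c ≈ 0# → c ≡ 0F
    scalar-zero zero             _  = refl
    scalar-zero (suc zero)       eq = contradiction eq 1≉0
    -- In F₃ one has 1 = 2 · 2, so if 2 vanishes then so does 1.
    scalar-zero (suc (suc zero)) eq =
      contradiction (≈-trans (*-homo 2F 2F) (≈-trans (*-congˡ eq) (zeroʳ _))) 1≉0

    coefficients-zero : ∀ {m} (v : Vec F₃ m) → All (_≈ 0#) (coefficients v) → v ≡ 0ᵥ
    coefficients-zero []      []       = refl
    coefficients-zero (c ∷ v) (p ∷ ps) = cong₂ _∷_ (scalar-zero c p) (coefficients-zero v ps)

-- Periodic sequences

Periodic : ℕ → Sequence → Set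
Periodic m s = ∀ i → s (m ℕ.+ i) ≡ s i

apply-periodic : ∀ {m} p {s} → Periodic m s → Periodic m (apply p s)
apply-periodic (scalar c) per i = cong (c *₃_) (per i)
apply-periodic {m} shift {s} per i = trans (cong s (sym (ℕ.+-suc m i))) (per (suc i))
apply-periodic (p ⊕ q) per i = cong₂ _+₃_ (apply-periodic p per i) (apply-periodic q per i)
apply-periodic (p ⊛ q) per = apply-periodic p (apply-periodic q per)

periodic-multiple : ∀ {m s} → Periodic m s → ∀ k i → s (i ℕ.+ k ℕ.* m) ≡ s i
periodic-multiple {m} {s} per zero    i = cong s (ℕ.+-identityʳ i)
periodic-multiple {m} {s} per (suc k) i = begin
  s (i ℕ.+ (m ℕ.+ k ℕ.* m))  ≡⟨ cong s (ℕ.+-assoc i m _) ⟨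
  s (i ℕ.+ m ℕ.+ k ℕ.* m)    ≡⟨ cong (λ j → s (j ℕ.+ k ℕ.* m)) (ℕ.+-comm i m) ⟩
  s (m ℕ.+ i ℕ.+ k ℕ.* m)    ≡⟨ periodic-multiple per k (m ℕ.+ i) ⟩
  s (m ℕ.+ i)                ≡⟨ per i ⟩
  s i                        ∎
  where open ≡-Reasoning

periodic-% : ∀ {m s} .{{_ : ℕ.NonZero m}} → Periodic m s → ∀ i → s i ≡ s (i % m)
periodic-% {m} {s} per i =
  trans (cong s (ℕ.m≡m%n+[m/n]*n i m)) (periodic-multiple per (i / m) (i % m))

-- Agreement on one period suffices. This makes the case distinctions of the construction
-- constructive.
≈[]-dec : ∀ m {s} → Periodic (suc m) s → ∀ p q → Dec (p ≈[ s ] q)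
≈[]-dec m {s} per p q = map′ extend (λ (agree e) j → e (Fin.toℕ j))
  (all? {suc m} λ j → apply p s (Fin.toℕ j) ≟ apply q s (Fin.toℕ j))
  where
  extend : (∀ (j : Fin (suc m)) → apply p s (Fin.toℕ j) ≡ apply q s (Fin.toℕ j)) → p ≈[ s ] q
  extend e = agree λ i → begin
    apply p s i            ≡⟨ periodic-% (apply-periodic p per) i ⟩
    apply p s (i % suc m)  ≡⟨ subst (λ j → apply p s j ≡ apply q s j)
                                (toℕ-fromℕ< _) (e (Fin.fromℕ< (ℕ.m%n<n i (suc m)))) ⟩
    apply q s (i % suc m)  ≡⟨ periodic-% (apply-periodic q per) i ⟨
    apply q s i            ∎
    where open ≡-Reasoning

-- The product of the X^(3ᵈ) - X over 0 < d ≤ k.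
obstruction : ℕ → Operator
obstruction zero    = scalar 1F
obstruction (suc k) = (power shift (3 ^ suc k) ⊕ scalar 2F ⊛ shift) ⊛ obstruction k

degree : ℕ → ℕ
degree zero    = 0
degree (suc k) = 3 ^ suc k ℕ.+ degree k

-- A geometric sum. The margin of 2 keeps the degree below 3ᵏ⁺¹ - 1, the period used later, and not
-- merely below 3ᵏ⁺¹.
degree<3^ : ∀ k → 2 ℕ.+ degree k ≤ 3 ^ suc k
degree<3^ zero    = s≤s (s≤s z≤n)
degree<3^ (suc k) = begin
  2 ℕ.+ (3 ^ suc k ℕ.+ degree k)    ≡⟨ ℕ.+-assoc 2 (3 ^ suc k) (degree k) ⟨
  2 ℕ.+ 3 ^ suc k ℕ.+ degree k      ≡⟨ cong (ℕ._+ degree k) (ℕ.+-comm 2 (3 ^ suc k)) ⟩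
  3 ^ suc k ℕ.+ 2 ℕ.+ degree k      ≡⟨ ℕ.+-assoc (3 ^ suc k) 2 (degree k) ⟩
  3 ^ suc k ℕ.+ (2 ℕ.+ degree k)    ≤⟨ ℕ.+-monoʳ-≤ (3 ^ suc k) (degree<3^ k) ⟩
  3 ^ suc k ℕ.+ 3 ^ suc k           ≤⟨ ℕ.+-monoʳ-≤ (3 ^ suc k) (ℕ.m≤m+n _ _) ⟩
  3 ^ suc (suc k)                   ∎
  where open ℕ.≤-Reasoning

-- Index 0 is exempt, since a sequence with period t that is nonzero at t is nonzero at 0.
FirstNonzero : ℕ → Sequence → Set
FirstNonzero t s = s t ≢ 0F × (∀ j → 0 < j → j < t → s j ≡ 0F)

-- A factor X^a - X moves the first nonzero index down by a: there its term X^a reads the nonzero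
-- value, while its term X reads one place further on, still among the zeros because a ≥ 2.
obstruction-first : ∀ k {t s} → 0 < t → FirstNonzero (t ℕ.+ degree k) s →
                    FirstNonzero t (apply (obstruction k) s)
obstruction-first zero {t} {s} 0<t first = subst (λ u → FirstNonzero u s) (ℕ.+-identityʳ t) first
obstruction-first (suc k) {t} {s} 0<t first = nonzero ∘ trans (sym at-t) , before-t
  where
  open ≡-Reasoning

  a : ℕ
  a = 3 ^ suc k

  2≤a : 2 ≤ a
  2≤a = ℕ.≤-trans (ℕ.m≤m+n 2 (degree k)) (degree<3^ k)

  2+t≤t+a : 2 ℕ.+ t ≤ t ℕ.+ a
  2+t≤t+a = subst (_≤ t ℕ.+ a) (ℕ.+-comm t 2) (ℕ.+-monoʳ-≤ t 2≤a)

  u : Sequence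
  u = apply (obstruction k) s

  u-first : FirstNonzero (t ℕ.+ a) u
  u-first = obstruction-first k (ℕ.≤-trans 0<t (ℕ.m≤m+n t a))
    (subst (λ v → FirstNonzero v s) (sym (ℕ.+-assoc t a (degree k))) first)

  nonzero : u (t ℕ.+ a) ≢ 0F
  nonzero = proj₁ u-first

  zeros : ∀ j → 0 < j → j < t ℕ.+ a → u j ≡ 0F
  zeros = proj₂ u-first

  factor : ∀ j → apply (obstruction (suc k)) s j ≡ u (j ℕ.+ a) +₃ (2F *₃ u (suc j))
  factor j = cong (_+₃ (2F *₃ u (suc j)))
    (trans (apply-shift-power a u j) (cong u (ℕ.+-comm a j)))

  at-t : apply (obstruction (suc k)) s t ≡ u (t ℕ.+ a)
  at-t = begin
    apply (obstruction (suc k)) s t         ≡⟨ factor t ⟩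
    u (t ℕ.+ a) +₃ (2F *₃ u (suc t))        ≡⟨ cong (λ y → u (t ℕ.+ a) +₃ (2F *₃ y))
                                                 (zeros (suc t) z<s 2+t≤t+a) ⟩
    u (t ℕ.+ a) +₃ 0F                       ≡⟨ +₃-identityʳ _ ⟩
    u (t ℕ.+ a)                             ∎

  before-t : ∀ j → 0 < j → j < t → apply (obstruction (suc k)) s j ≡ 0F
  before-t j 0<j j<t = begin
    apply (obstruction (suc k)) s j         ≡⟨ factor j ⟩
    u (j ℕ.+ a) +₃ (2F *₃ u (suc j))        ≡⟨ cong₂ (λ x y → x +₃ (2F *₃ y))
      (zeros (j ℕ.+ a) (ℕ.m≤n⇒m≤n+o a 0<j) (ℕ.+-monoˡ-< a j<t))
      (zeros (suc j) z<s (ℕ.<-≤-trans (s≤s j<t) (ℕ.<⇒≤ 2+t≤t+a))) ⟩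
    0F                                      ∎

-- Equivalent to the injectivity of x ↦ f (x + a) - f x for every nonzero a. In this form it is
-- precisely what makes the graph of `f` Sidon.
Planar : ∀ {n} → (Point n → Point n) → Set
Planar f = ∀ {x y z w} → x +ᵥ y ≡ z +ᵥ w → f x +ᵥ f y ≡ f z +ᵥ f w → x ≡ z ⊎ x ≡ w

-- The period is 3ⁿ - 1, so that X, and with it every element, is fixed by the 3ⁿ-th power.
module FieldConstruction (n′ m : ℕ) (3ⁿ≡2+m : 3 ^ suc n′ ≡ suc (suc m)) where

  private
    n M : ℕ
    n = suc n′
    M = suc m

  -- Quotients by periodic sequences

  module _ {s : Sequence} (per : Periodic M s) where
    open Quotient s
    open SetoidReasoning setoid

    shift⋆M : shift ⋆ M ≈ 1#
    shift⋆M = begin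
      shift ⋆ M      ≡⟨ power≡⋆ s shift M ⟨
      power shift M  ≈⟨ agree (λ i → trans (apply-shift-power M s i) (per i)) ⟩
      1#             ∎

    -- The 3ⁿ-th power is additive and multiplicative, and it fixes the scalars and, as X^M = 1,
    -- also X. All operators are built from these.
    ⋆3ⁿ : ∀ p → p ⋆ (3 ^ n) ≈ p
    ⋆3ⁿ (scalar c) = frobenius-scalar s n c
    ⋆3ⁿ shift = begin
      shift ⋆ (3 ^ n)     ≡⟨ cong (shift ⋆_) 3ⁿ≡2+m ⟩
      shift ⊛ shift ⋆ M   ≈⟨ *-congˡ {shift} shift⋆M ⟩
      shift ⊛ 1#          ≈⟨ *-identityʳ shift ⟩
      shift               ∎
    ⋆3ⁿ (p ⊕ q) = ≈-trans (frobenius-+ n p q) (+-cong (⋆3ⁿ p) (⋆3ⁿ q))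
    ⋆3ⁿ (p ⊛ q) = ≈-trans (^-distrib-* p q (3 ^ n)) (*-cong (⋆3ⁿ p) (⋆3ⁿ q))

    ⋆[1+M] : ∀ p → p ⋆ (suc M) ≈ p
    ⋆[1+M] p = ≈-trans (reflexive (cong (p ⋆_) (sym 3ⁿ≡2+m))) (⋆3ⁿ p)

    -- p^M p^M = p^(M+1) p^(M-1), and p^(M+1) = p.
    ⋆M-idempotent : ∀ p → p ⋆ M ⊛ p ⋆ M ≈ p ⋆ M
    ⋆M-idempotent p = begin
      p ⋆ M ⊛ (p ⊛ p ⋆ m)  ≈⟨ *-assoc (p ⋆ M) p (p ⋆ m) ⟨
      p ⋆ M ⊛ p ⊛ p ⋆ m    ≈⟨ *-congʳ {p ⋆ m} (*-comm (p ⋆ M) p) ⟩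
      p ⋆ suc M ⊛ p ⋆ m    ≈⟨ *-congʳ {p ⋆ m} (⋆[1+M] p) ⟩
      p ⊛ p ⋆ m            ∎

    -- There are only finitely many vectors of length M, so a property needed for all operators can
    -- be arranged by treating them one at a time.
    Reducible : Operator → Set
    Reducible p = ∃[ v ] p ≈ horner {M} v shift

    reducible-resp : ∀ {p q} → p ≈ q → Reducible q → Reducible p
    reducible-resp eq (v , eq′) = v , ≈-trans eq eq′

    reducible-+ : ∀ {p q} → Reducible p → Reducible q → Reducible (p ⊕ q)
    reducible-+ (v , p≈v) (w , q≈w) = v +ᵥ w , ≈-trans (+-cong p≈v q≈w) (horner-+ s v w shift)

    reducible-· : ∀ c {p} → Reducible p → Reducible (scalar c ⊛ p)
    reducible-· c (v , p≈v) = c ·ᵥ v , ≈-trans (*-congˡ p≈v) (horner-· s c v shift)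

    -- As X^M = 1, the leading coefficient wraps around and becomes the constant one.
    reducible-shift : ∀ {p} → Reducible p → Reducible (shift ⊛ p)
    reducible-shift {p} (v , p≈v) with initLast v
    ... | w , c , refl = c ∷ w , (begin
      shift ⊛ p                                      ≈⟨ *-congˡ {shift} p≈v ⟩
      shift ⊛ horner (w ∷ʳ c) shift                  ≈⟨ *-congˡ {shift} (horner-∷ʳ s w c shift) ⟩
      shift ⊛ (horner w shift ⊕ scalar c ⊛ shift ⋆ m)
        ≈⟨ solve 4 (λ x p c y → x :* (p :+ c :* y) := c :* (x :* y) :+ x :* p)
                 ≈-refl shift (horner w shift) (scalar c) (shift ⋆ m) ⟩
      scalar c ⊛ shift ⋆ M ⊕ shift ⊛ horner w shift  ≈⟨ +-congʳ (*-congˡ {scalar c} shift⋆M) ⟩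
      scalar c ⊛ 1# ⊕ shift ⊛ horner w shift         ≈⟨ +-congʳ (*-identityʳ (scalar c)) ⟩
      scalar c ⊕ shift ⊛ horner w shift              ∎)

    reducible-scalar : ∀ c → Reducible (scalar c)
    reducible-scalar c = c ∷ 0ᵥ , (begin
      scalar c                                  ≈⟨ c+x*0≈c (scalar c) shift ⟨
      scalar c ⊕ shift ⊛ 0#
        ≈⟨ +-congˡ (*-congˡ {shift} (horner-0ᵥ s m shift)) ⟨
      scalar c ⊕ shift ⊛ horner (0ᵥ {m}) shift  ∎)

    reducible-horner-* : ∀ {k} (v : Vec F₃ k) {q} → Reducible q → Reducible (horner v shift ⊛ q)
    reducible-horner-* []      red     = reducible-· 0F red
    reducible-horner-* (c ∷ v) {q} red = reducible-resp (distribʳ q (scalar c) _)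
      (reducible-+ (reducible-· c red)
        (reducible-resp (*-assoc shift (horner v shift) q)
          (reducible-shift (reducible-horner-* v red))))

    reducible : ∀ p → Reducible p
    reducible (scalar c) = reducible-scalar c
    reducible shift      =
      reducible-resp (≈-sym (*-identityʳ shift)) (reducible-shift (reducible-scalar 1F))
    reducible (p ⊕ q)    = reducible-+ (reducible p) (reducible q)
    reducible (p ⊛ q)    =
      let v , p≈v = reducible p
      in reducible-resp (*-congʳ p≈v) (reducible-horner-* v (reducible q))

  -- The initial sequence

  δ₀ : Sequence
  δ₀ zero    = 1F
  δ₀ (suc _) = 0F

  -- The quotient by this sequence is F₃[X] modulo X^M - 1: the coefficients of a polynomial of
  -- degree below M can be read off from its action.
  impulse : Sequence
  impulse i = δ₀ (i % M)

  impulse-periodic : Periodic M impulse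
  impulse-periodic i =
    cong δ₀ (trans (cong (_% M) (ℕ.+-comm M i)) (ℕ.[m+n]%n≡m%n i M))

  impulse-first : FirstNonzero M impulse
  impulse-first = (λ eq → contradiction (trans (sym (cong δ₀ (ℕ.n%n≡0 M))) eq) λ ())
                , λ { (suc j) _ j<M → cong δ₀ (ℕ.m<n⇒m%n≡m j<M) }

  -- The nonzero entry at M is moved to the index M - `degree n′`, which is positive, so the image
  -- of the impulse is not the zero sequence.
  impulse-unobstructed : ¬ obstruction n′ ≈[ impulse ] scalar 0F
  impulse-unobstructed (agree e) = proj₁ first (e t)
    where
    t : ℕ
    t = M ℕ.∸ degree n′
    degree<M : degree n′ < M
    degree<M = s≤s⁻¹ (subst (2 ℕ.+ degree n′ ≤_) 3ⁿ≡2+m (degree<3^ n′))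
    first : FirstNonzero t (apply (obstruction n′) impulse)
    first = obstruction-first n′ (ℕ.m<n⇒0<n∸m degree<M)
      (subst (λ v → FirstNonzero v impulse) (sym (ℕ.m∸n+n≡m (ℕ.<⇒≤ degree<M))) impulse-first)

  -- Splitting by idempotents

  Split : Sequence → Operator → Set
  Split s p = power p M ≈[ s ] scalar 0F ⊎ power p M ≈[ s ] scalar 1F

  split-apply : ∀ {s p} r → Split s p → Split (apply r s) p
  split-apply r = Sum.map (≈-apply r) (≈-apply r)

  split-resp : ∀ {s p q} → p ≈[ s ] q → Split s q → Split s p
  split-resp {s} {p} {q} p≈q = Sum.map (≈-trans same) (≈-trans same)
    where
    open Quotient s
    same : power p M ≈ power q M
    same = ≈-trans (reflexive (power≡⋆ s p M))
      (≈-trans (^-congˡ M p≈q) (reflexive (sym (power≡⋆ s q M))))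

  Unobstructed : Sequence → Set
  Unobstructed s = Periodic M s × ¬ obstruction n′ ≈[ s ] scalar 0F

  -- With f = p^M idempotent, passing to f s turns f into 1, and passing to (1 - f) s turns it into
  -- 0. Since b = b f + b (1 - f), the obstruction b cannot vanish in both cases, and deciding b f =
  -- 0 selects a good one.
  split-step : ∀ s p → Unobstructed s → ∃[ r ] Unobstructed (apply r s) × Split (apply r s) p
  split-step s p (per , b≉0) = choose (≈[]-dec m per (b ⊛ f) 0#)
    where
    open Quotient s
    open SetoidReasoning setoid

    b f g : Operator
    b = obstruction n′
    f = power p M
    g = 1# - f

    f²≈f : f ⊛ f ≈ f
    f²≈f rewrite power≡⋆ s p M = ⋆M-idempotent per p

    fg≈0 : f ⊛ g ≈ 0#
    fg≈0 = begin
      f ⊛ g      ≈⟨ solve 1 (λ f → f :* (con 1F :- f) := f :- f :* f) ≈-refl f ⟩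
      f - f ⊛ f  ≈⟨ +-congˡ (-‿cong f²≈f) ⟩
      f - f      ≈⟨ -‿inverseʳ f ⟩
      0#         ∎

    both-vanish : b ⊛ f ≈ 0# → b ⊛ g ≈ 0# → b ≈ 0#
    both-vanish bf≈0 bg≈0 = begin
      b              ≈⟨ solve 2 (λ b f → b := b :* f :+ b :* (con 1F :- f)) ≈-refl b f ⟩
      b ⊛ f ⊕ b ⊛ g  ≈⟨ +-cong bf≈0 bg≈0 ⟩
      0# ⊕ 0#        ≈⟨ +-identityˡ 0# ⟩
      0#             ∎

    -- p ⊛ r ≈[ s ] q ⊛ r and p ≈[ apply r s ] q have the same content.
    choose : Dec (b ⊛ f ≈ 0#) → ∃[ r ] Unobstructed (apply r s) × Split (apply r s) p
    choose (no bf≉0)  =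
      f , (apply-periodic f per , λ (agree e) → bf≉0 (agree e)) , inj₂ (agree (agreement f²≈f))
    choose (yes bf≈0) =
      g , (apply-periodic g per , λ (agree e) → b≉0 (both-vanish bf≈0 (agree e)))
        , inj₁ (agree (agreement fg≈0))

  split-all : ∀ ps → ∃[ s ] Unobstructed s × All (Split s) ps
  split-all []       = impulse , (impulse-periodic , impulse-unobstructed) , []
  split-all (p ∷ ps) =
    let s , unobstructed , splits = split-all ps
        r , unobstructed′ , split = split-step s p unobstructed
    in apply r s , unobstructed′ , split ∷ All.map (split-apply r) splits

  -- The resulting field with 3ⁿ elements

  module _ {s : Sequence} (per : Periodic M s) (b≉0 : ¬ obstruction n′ ≈[ s ] scalar 0F)
           (split : ∀ p → Split s p) where
    open Quotient s
    open SetoidReasoning setoid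

    -- If x^M = 0 then x = x^(M+1) = 0. If x^M = 1 then x is a unit with inverse x^(M-1) and can be
    -- cancelled.
    noZeroDivisors : NoZeroDivisors
    noZeroDivisors {x} {y} xy≈0 = Sum.map vanish cancel (split x)
      where
      vanish : power x M ≈ 0# → x ≈ 0#
      vanish eq = begin
        x              ≈⟨ ⋆[1+M] per x ⟨
        x ⊛ x ⋆ M      ≡⟨ cong (x ⊛_) (power≡⋆ s x M) ⟨
        x ⊛ power x M  ≈⟨ *-congˡ eq ⟩
        x ⊛ 0#         ≈⟨ zeroʳ x ⟩
        0#             ∎

      cancel : power x M ≈ 1# → y ≈ 0#
      cancel eq = begin
        y                    ≈⟨ *-identityˡ y ⟨
        1# ⊛ y               ≈⟨ *-congʳ eq ⟨
        x ⊛ power x m ⊛ y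
          ≈⟨ solve 3 (λ x p y → x :* p :* y := p :* (x :* y)) ≈-refl x (power x m) y ⟩
        power x m ⊛ (x ⊛ y)  ≈⟨ *-congˡ xy≈0 ⟩
        power x m ⊛ 0#       ≈⟨ zeroʳ (power x m) ⟩
        0#                   ∎

    1≈0⇒≈0 : 1# ≈ 0# → ∀ x → x ≈ 0#
    1≈0⇒≈0 eq x = ≈-trans (≈-sym (*-identityʳ x)) (≈-trans (*-congˡ eq) (zeroʳ x))

    1≉0 : 1# ≉ 0#
    1≉0 eq = b≉0 (1≈0⇒≈0 eq _)

    ⋆-≈0 : ∀ x k → x ⋆ k ≈ 0# → x ≈ 0#
    ⋆-≈0 x zero    eq = 1≈0⇒≈0 eq x
    ⋆-≈0 x (suc k) eq = [ id , ⋆-≈0 x k ]′ (noZeroDivisors eq)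

    -- For d < k the vanishing element is one of the factors of `obstruction k`.
    obstruction-vanishes : ∀ {d} k → d < k → shift ⋆ (3 ^ suc d) - shift ≈ 0# →
                           obstruction k ≈ 0#
    obstruction-vanishes {d} (suc k) d<1+k eq with d ℕ.≟ k
    ... | yes refl = begin
      (power shift (3 ^ suc d) - shift) ⊛ o
        ≡⟨ cong (λ p → (p - shift) ⊛ o) (power≡⋆ s shift (3 ^ suc d)) ⟩
      (shift ⋆ (3 ^ suc d) - shift) ⊛ o  ≈⟨ *-congʳ {o} eq ⟩
      0# ⊛ o                             ≈⟨ zeroˡ o ⟩
      0#                                 ∎
      where o = obstruction d
    ... | no d≢k =
      ≈-trans (*-congˡ (obstruction-vanishes k (ℕ.≤∧≢⇒< (s≤s⁻¹ d<1+k) d≢k) eq)) (zeroʳ _)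

    conjugate : ℕ → Operator
    conjugate i = shift ⋆ (3 ^ i)

    -- The difference of the two conjugates is the 3ⁱ-th power of X^(3^(j-i)) - X. If it vanished,
    -- so would that base, which is a factor of the obstruction. Here j - i = `suc d`.
    conjugates-distinct : ∀ {i j} → i < j → j < n → conjugate i ≉ conjugate j
    conjugates-distinct {i} {j} i<j j<n eq with ℕ.m≤n⇒∃[o]m+o≡n i<j
    ... | d , refl =
      b≉0 (obstruction-vanishes n′ (ℕ.≤-trans (s≤s (ℕ.m≤n+m d i)) (s≤s⁻¹ j<n))
        (⋆-≈0 _ (3 ^ i) (begin
          (shift ⋆ (3 ^ suc d) - shift) ⋆ (3 ^ i)
            ≈⟨ frobenius-+ i _ _ ⟩
          (shift ⋆ (3 ^ suc d)) ⋆ (3 ^ i) ⊕ (scalar 2F ⊛ shift) ⋆ (3 ^ i)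
            ≈⟨ +-cong (^-assocʳ shift (3 ^ suc d) (3 ^ i))
                      (^-distrib-* (scalar 2F) shift (3 ^ i)) ⟩
          shift ⋆ (3 ^ suc d ℕ.* 3 ^ i) ⊕ scalar 2F ⋆ (3 ^ i) ⊛ conjugate i
            ≈⟨ +-cong (reflexive (cong (shift ⋆_) exponent))
                      (*-congʳ {conjugate i} (frobenius-scalar s i 2F)) ⟩
          conjugate (suc (i ℕ.+ d)) - conjugate i
            ≈⟨ +-congʳ eq ⟨
          conjugate i - conjugate i
            ≈⟨ -‿inverseʳ (conjugate i) ⟩
          0# ∎)))
      where
      exponent : 3 ^ suc d ℕ.* 3 ^ i ≡ 3 ^ suc (i ℕ.+ d)
      exponent = trans (sym (ℕ.^-distribˡ-+-* 3 (suc d) i)) (cong (λ k → 3 ^ suc k) (ℕ.+-comm d i))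

    element : Point n → Operator
    element v = horner v shift

    -- A polynomial of degree below n that vanishes at X also vanishes at its n distinct conjugates,
    -- which is one root too many.
    element-zero⇒ : ∀ v → element v ≈ 0# → v ≡ 0ᵥ
    element-zero⇒ v eq = horner-zero⇒ s 1≉0 noZeroDivisors v (applyUpTo conjugate n)
      (ℕ.≤-reflexive (sym (length-applyUpTo conjugate n)))
      (AllPairs.applyUpTo⁺₁ conjugate n conjugates-distinct)
      (All.applyUpTo⁺₂ conjugate n λ i →
        ≈-trans (frobenius-horner s i v shift)
          (≈-trans (^-congˡ (3 ^ i) eq) (frobenius-scalar s i 0F)))

    element-injective : ∀ {v w} → element v ≈ element w → v ≡ w
    element-injective {v} {w} eq = a-b≡0⇒a≡b v w (element-zero⇒ (v +ᵥ (2F ·ᵥ w)) (begin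
      element (v +ᵥ (2F ·ᵥ w))            ≈⟨ horner-+ s v (2F ·ᵥ w) shift ⟨
      element v ⊕ element (2F ·ᵥ w)       ≈⟨ +-cong eq (≈-sym (horner-· s 2F w shift)) ⟩
      element w - element w               ≈⟨ -‿inverseʳ (element w) ⟩
      0#                                  ∎))

    -- Here `2F` is -1, and the m zeros place the final 1 at degree M + 1 = 3ⁿ.
    Yᴺ-Y : Vec F₃ (suc (suc M))
    Yᴺ-Y = 0F ∷ 2F ∷ (0ᵥ ∷ʳ 1F)

    Yᴺ-Y-root : ∀ x → horner Yᴺ-Y x ≈ 0#
    Yᴺ-Y-root x = begin
      0# ⊕ x ⊛ (scalar 2F ⊕ x ⊛ horner (0ᵥ {m} ∷ʳ 1F) x)
        ≈⟨ +-congˡ (*-congˡ {x} (+-congˡ (*-congˡ {x} leading))) ⟩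
      0# ⊕ x ⊛ (scalar 2F ⊕ x ⊛ x ⋆ m)
        ≈⟨ solve 2 (λ x y → con 0F :+ x :* (con 2F :+ x :* y) := x :* (x :* y) :- x)
                 ≈-refl x (x ⋆ m) ⟩
      x ⋆ suc M - x
        ≈⟨ +-congʳ (⋆[1+M] per x) ⟩
      x - x
        ≈⟨ -‿inverseʳ x ⟩
      0# ∎
      where
      leading : horner (0ᵥ {m} ∷ʳ 1F) x ≈ x ⋆ m
      leading = begin
        horner (0ᵥ {m} ∷ʳ 1F) x           ≈⟨ horner-∷ʳ s (0ᵥ {m}) 1F x ⟩
        horner (0ᵥ {m}) x ⊕ 1# ⊛ x ⋆ m    ≈⟨ +-cong (horner-0ᵥ s m x) (*-identityˡ (x ⋆ m)) ⟩
        0# ⊕ x ⋆ m                        ≈⟨ +-identityˡ (x ⋆ m) ⟩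
        x ⋆ m                             ∎

    -- An operator outside the list of the 3ⁿ elements would be a further root of Y^(3ⁿ) - Y,
    -- forcing its coefficients to be zero, which they are not.
    element-surjective : ∀ p → ∃[ v ] p ≈ element v
    element-surjective p with Any.any? (λ v → ≈[]-dec m per p (element v)) (allPoints n)
    ... | yes p∈ = Any.satisfied p∈
    ... | no p∉  = contradiction
      (horner-zero⇒ s 1≉0 noZeroDivisors Yᴺ-Y (p ∷ elements) (s≤s (ℕ.≤-reflexive (sym count)))
        (All.map⁺ (All.¬Any⇒All¬ _ p∉) ∷ distinct) (All.universal Yᴺ-Y-root _))
      λ ()
      where
      elements : List Operator
      elements = map element (allPoints n)

      count : length elements ≡ suc M
      count = trans (length-map element (allPoints n)) (trans (length-allPoints n) 3ⁿ≡2+m)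

      distinct : AllPairs _≉_ elements
      distinct = AllPairs.map⁺
        (AllPairs.map (λ v≢w eq → v≢w (element-injective eq)) (allPoints-unique n))

    square : Point n → Point n
    square v = proj₁ (element-surjective (element v ⊛ element v))

    element-square : ∀ v → element v ⊛ element v ≈ element (square v)
    element-square v = proj₂ (element-surjective (element v ⊛ element v))

    element-sums : ∀ {a b c d} → a +ᵥ b ≡ c +ᵥ d → element a ⊕ element b ≈ element c ⊕ element d
    element-sums {a} {b} {c} {d} eq = begin
      element a ⊕ element b  ≈⟨ horner-+ s a b shift ⟩
      element (a +ᵥ b)       ≡⟨ cong element eq ⟩
      element (c +ᵥ d)       ≈⟨ horner-+ s c d shift ⟨
      element c ⊕ element d  ∎

    square-planar : Planar square
    square-planar {x} {y} {z} {w} sum squares = Sum.map element-injective element-injective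
      (squares-determine-summands noZeroDivisors (element-sums sum) (begin
        element x ⊛ element x ⊕ element y ⊛ element y
          ≈⟨ +-cong (element-square x) (element-square y) ⟩
        element (square x) ⊕ element (square y)
          ≈⟨ element-sums squares ⟩
        element (square z) ⊕ element (square w)
          ≈⟨ +-cong (element-square z) (element-square w) ⟨
        element z ⊛ element z ⊕ element w ⊛ element w ∎))

planar-exists : ∀ n → ∃[ f ] Planar {n} f
-- For n = 0 the period 3ⁿ - 1 would be 0; the space has a single point.
planar-exists zero = id , λ { {[]} {[]} {[]} {[]} _ _ → inj₁ refl }
planar-exists (suc n′) =
  let m , 2+m≡3ⁿ = ℕ.m≤n⇒∃[o]m+o≡n (ℕ.≤-trans (ℕ.m≤m+n 2 _) (degree<3^ n′))
      open FieldConstruction n′ m (sym 2+m≡3ⁿ)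
      -- It suffices to split the representatives with M coefficients, because each operator agrees
      -- with one of them.
      s , (per , b≉0) , splits = split-all (map (λ v → horner v shift) (allPoints (suc m)))
      split = λ p → let v , p≈v = reducible per p
                    in split-resp p≈v (All.lookup (All.map⁻ splits) (∈-allPoints v))
  in square per b≉0 split , square-planar per b≉0 split

-- The upper bound

-- Coefficients come from a function on points, so that relations can be added up without knowing
-- where the points stand in `S`.
weights : ∀ {A : Set} → (A → F₃) → (S : List A) → Vec F₃ (length S)
weights κ []      = []
weights κ (p ∷ S) = κ p ∷ weights κ S

coeffSum-weights-+ : ∀ {A : Set} (κ μ : A → F₃) S →
  coeffSum (weights (λ p → κ p +₃ μ p) S) ≡ coeffSum (weights κ S) +₃ coeffSum (weights μ S)
coeffSum-weights-+ κ μ []      = refl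
coeffSum-weights-+ κ μ (p ∷ S) =
  trans (cong ((κ p +₃ μ p) +₃_) (coeffSum-weights-+ κ μ S)) (+₃-medial (κ p) (μ p) _ _)

linComb-weights-+ : ∀ {n} (κ μ : Point n → F₃) S →
  linComb S (weights (λ p → κ p +₃ μ p) S) ≡ linComb S (weights κ S) +ᵥ linComb S (weights μ S)
linComb-weights-+ κ μ []      = sym (+ᵥ-identityˡ 0ᵥ)
linComb-weights-+ κ μ (p ∷ S) =
  trans (cong₂ _+ᵥ_ (·ᵥ-distribʳ (κ p) (μ p) p) (linComb-weights-+ κ μ S)) (+ᵥ-medial _ _ _ _)

spike : ∀ {n} → F₃ → Point n → Point n → F₃
spike x a p with a ≟ᵥ p
... | yes _ = x
... | no _  = 0F

spike-∉ : ∀ {n} x (a : Point n) {S} → All (a ≢_) S →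
  coeffSum (weights (spike x a) S) ≡ 0F × linComb S (weights (spike x a) S) ≡ 0ᵥ
spike-∉ x a []                 = refl , refl
spike-∉ x a {p ∷ S} (a≢p ∷ a≢S) with a ≟ᵥ p
... | yes a≡p = contradiction a≡p a≢p
... | no _    = let c , l = spike-∉ x a a≢S in c , trans (cong₂ _+ᵥ_ (0·ᵥ p) l) (+ᵥ-identityˡ 0ᵥ)

spike-∈ : ∀ {n} x {a : Point n} {S} → Unique S → a ∈ S →
  coeffSum (weights (spike x a) S) ≡ x × linComb S (weights (spike x a) S) ≡ x ·ᵥ a
spike-∈ x {a} {p ∷ S} (p≢S ∷ u) a∈ with a ≟ᵥ p | a∈
... | yes refl | _         =
  let c , l = spike-∉ x a p≢S
  in trans (cong (x +₃_) c) (+₃-identityʳ x) , trans (cong ((x ·ᵥ a) +ᵥ_) l) (+ᵥ-identityʳ _)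
... | no a≢p   | here a≡p  = contradiction a≡p a≢p
... | no _     | there a∈S =
  let c , l = spike-∈ x u a∈S
  in c , trans (cong₂ _+ᵥ_ (0·ᵥ p) l) (+ᵥ-identityˡ _)

spike-self : ∀ {n} x (a : Point n) → spike x a a ≡ x
spike-self x a with a ≟ᵥ a
... | yes _ = refl
... | no a≢a = contradiction refl a≢a

weights-zero : ∀ {A : Set} {κ : A → F₃} {S a} → weights κ S ≡ replicate _ 0F → a ∈ S → κ a ≡ 0F
weights-zero eq (here refl) = Vec.∷-injectiveˡ eq
weights-zero eq (there a∈S) = weights-zero (Vec.∷-injectiveʳ eq) a∈S

-- The relation a - b - c + d = 0 is read on the set of its points: the coefficients of coinciding
-- points are added up.
cap⇒differences-distinct : ∀ {n} {C : List (Point n)} → IsCap 2 n C →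
  ∀ {a b c d} → a ∈ C → b ∈ C → c ∈ C → d ∈ C → a +ᵥ d ≡ b +ᵥ c → a ≢ b → a ≡ c
cap⇒differences-distinct {n} {C} (unique , independent) {a} {b} {c} {d} a∈C b∈C c∈C d∈C eq a≢b =
  conclude (weights-zero (independent S (filter-⊆ (_∈? T) C) size (weights κ S) affine linear) a∈S)
  where
  open DecMembership (_≟ᵥ_ {n}) using (_∈?_)
  open ≡-Reasoning

  T S : List (Point n)
  T = a ∷ b ∷ c ∷ d ∷ []
  -- Filtering `C` gives a sublist without repetition, whichever of a, b, c, d coincide.
  S = filter (_∈? T) C

  S-unique : Unique S
  S-unique = Unique.filter⁺ (_∈? T) unique

  size : length S ≤ 4
  size = unique-length-≤ S-unique (proj₂ ∘ ∈-filter⁻ (_∈? T) {xs = C})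

  a∈S : a ∈ S
  a∈S = ∈-filter⁺ (_∈? T) a∈C (here refl)

  b∈S : b ∈ S
  b∈S = ∈-filter⁺ (_∈? T) b∈C (there (here refl))

  c∈S : c ∈ S
  c∈S = ∈-filter⁺ (_∈? T) c∈C (there (there (here refl)))

  d∈S : d ∈ S
  d∈S = ∈-filter⁺ (_∈? T) d∈C (there (there (there (here refl))))

  cd bcd κ : Point n → F₃
  cd p = spike 2F c p +₃ spike 1F d p
  bcd p = spike 2F b p +₃ cd p
  κ p = spike 1F a p +₃ bcd p

  affine : coeffSum (weights κ S) ≡ 0F
  affine = begin
    coeffSum (weights κ S)
      ≡⟨ coeffSum-weights-+ (spike 1F a) bcd S ⟩
    coeffSum (weights (spike 1F a) S) +₃ coeffSum (weights bcd S)
      ≡⟨ cong₂ _+₃_ (proj₁ (spike-∈ 1F S-unique a∈S)) (coeffSum-weights-+ (spike 2F b) cd S) ⟩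
    1F +₃ (coeffSum (weights (spike 2F b) S) +₃ coeffSum (weights cd S))
      ≡⟨ cong (1F +₃_) (cong₂ _+₃_ (proj₁ (spike-∈ 2F S-unique b∈S))
           (trans (coeffSum-weights-+ (spike 2F c) (spike 1F d) S)
             (cong₂ _+₃_ (proj₁ (spike-∈ 2F S-unique c∈S)) (proj₁ (spike-∈ 1F S-unique d∈S))))) ⟩
    0F ∎

  linear : linComb S (weights κ S) ≡ 0ᵥ
  linear = begin
    linComb S (weights κ S)
      ≡⟨ linComb-weights-+ (spike 1F a) bcd S ⟩
    linComb S (weights (spike 1F a) S) +ᵥ linComb S (weights bcd S)
      ≡⟨ cong₂ _+ᵥ_ (proj₂ (spike-∈ 1F S-unique a∈S)) (linComb-weights-+ (spike 2F b) cd S) ⟩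
    (1F ·ᵥ a) +ᵥ (linComb S (weights (spike 2F b) S) +ᵥ linComb S (weights cd S))
      ≡⟨ cong ((1F ·ᵥ a) +ᵥ_) (cong₂ _+ᵥ_ (proj₂ (spike-∈ 2F S-unique b∈S))
           (trans (linComb-weights-+ (spike 2F c) (spike 1F d) S)
             (cong₂ _+ᵥ_ (proj₂ (spike-∈ 2F S-unique c∈S)) (proj₂ (spike-∈ 1F S-unique d∈S))))) ⟩
    (1F ·ᵥ a) +ᵥ ((2F ·ᵥ b) +ᵥ ((2F ·ᵥ c) +ᵥ (1F ·ᵥ d)))
      ≡⟨ a+d≡b+c⇒a-b-c+d≡0 a b c d eq ⟩
    0ᵥ ∎

  conclude : κ a ≡ 0F → a ≡ c
  -- If neither b nor c equals a, the coefficient of a is 1, or 1 + 1 = 2 when d = a, and so it is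
  -- nonzero in F₃.
  conclude κa≡0 with b ≟ᵥ a | c ≟ᵥ a | d ≟ᵥ a
  ... | yes b≡a | _       | _     = contradiction (sym b≡a) a≢b
  ... | no _    | yes c≡a | _     = sym c≡a
  ... | no _    | no _    | yes _ =
    contradiction (trans (cong (_+₃ 1F) (sym (spike-self 1F a))) κa≡0) λ ()
  ... | no _    | no _    | no _  =
    contradiction (trans (cong (_+₃ 0F) (sym (spike-self 1F a))) κa≡0) λ ()

encode : ∀ {n} → Point n → Fin (3 ^ n)
encode v = funToFin (Vec.lookup v)

encode-injective : ∀ {n} {v w : Point n} → encode v ≡ encode w → v ≡ w
encode-injective {v = v} {w} eq = begin
  v                                   ≡⟨ decode v ⟨
  Vec.tabulate (finToFun (encode v))  ≡⟨ cong (Vec.tabulate ∘ finToFun) eq ⟩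
  Vec.tabulate (finToFun (encode w))  ≡⟨ decode w ⟩
  w                                   ∎
  where
  open ≡-Reasoning
  decode : ∀ v → Vec.tabulate (finToFun (encode v)) ≡ v
  decode v = trans (Vec.tabulate-cong (finToFun-funToFin (Vec.lookup v))) (Vec.tabulate∘lookup v)

-- The ordered pairs of distinct points of C have distinct differences.
cap-pairs-≤ : ∀ {n} (C : List (Point n)) {k} → length C ≡ suc k → IsCap 2 n C →
              suc k ℕ.* k ≤ 3 ^ n
cap-pairs-≤ {n} C@(_ ∷ _) {k} refl cap@(unique , _) =
  injective⇒≤ {f = encode ∘ difference ∘ pair} λ {x} {y} eq → begin
    x                         ≡⟨ combine-remQuot {suc k} k x ⟨
    uncurry combine (pair x)  ≡⟨ cong (uncurry combine)
                                   (difference-injective (pair x) (pair y) (encode-injective eq)) ⟩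
    uncurry combine (pair y)  ≡⟨ combine-remQuot {suc k} k y ⟩
    y                         ∎
  where
  open ≡-Reasoning

  pair : Fin (suc k ℕ.* k) → Fin (suc k) × Fin k
  pair = remQuot {suc k} k

  at : Fin (suc k) → Point n
  at = lookup C

  difference : Fin (suc k) × Fin k → Point n
  difference (i , j) = at i +ᵥ (2F ·ᵥ at (punchIn i j))

  difference-injective : ∀ x y → difference x ≡ difference y → x ≡ y
  difference-injective (i , j) (i′ , j′) eq
    with a-b≡c-d⇒a+d≡b+c (at i) (at (punchIn i j)) (at i′) (at (punchIn i′ j′)) eq
  ... | eq′
    with unique-lookup-injective unique i i′
      (cap⇒differences-distinct cap (∈-lookup i) (∈-lookup (punchIn i j))
        (∈-lookup i′) (∈-lookup (punchIn i′ j′)) eq′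
        λ same → punchInᵢ≢i i j (sym (unique-lookup-injective unique i (punchIn i j) same)))
  -- The first points coincide, so cancelling them leaves equal second points.
  ... | refl = cong (i ,_) (punchIn-injective i j j′ (sym
    (unique-lookup-injective unique (punchIn i j′) (punchIn i j)
      (a+d≡b+a⇒d≡b (at i) (at (punchIn i j)) (at (punchIn i j′)) eq′))))

-- Let N = 3^q. If N < k + 1, then N ≤ k and N² < (k + 1) N ≤ (k + 1) k ≤ N², a contradiction.
cap-length-≤ : ∀ q (C : List (Point (q ℕ.+ q))) → IsCap 2 (q ℕ.+ q) C → length C ≤ 3 ^ q
cap-length-≤ q C cap with length C in eq
... | zero  = z≤n
... | suc k = ℕ.≮⇒≥ λ N<1+k → ℕ.<⇒≱ (begin-strict
    3 ^ (q ℕ.+ q)      ≡⟨ ℕ.^-distribˡ-+-* 3 q q ⟩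
    3 ^ q ℕ.* 3 ^ q    <⟨ ℕ.*-monoˡ-< (3 ^ q) {{ℕ.m^n≢0 3 q}} N<1+k ⟩
    suc k ℕ.* 3 ^ q    ≤⟨ ℕ.*-monoʳ-≤ (suc k) (s≤s⁻¹ N<1+k) ⟩
    suc k ℕ.* k        ∎) (cap-pairs-≤ C eq cap)
  where open ℕ.≤-Reasoning

-- The lower bound

-- Locating a is enough: b is then the other point by cancellation.
Sidon : ∀ {n} → List (Point n) → Set
Sidon C = ∀ {a b c d} → a ∈ C → b ∈ C → c ∈ C → d ∈ C → a +ᵥ b ≡ c +ᵥ d → a ≡ c ⊎ a ≡ d

-- Affine relations as equalities of sums

module _ {A : Set} where

  -- Because 2 = -1, an affine relation says that the points with coefficient 1 and those with
  -- coefficient 2 have equal sums and, modulo 3, equal numbers.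
  support : F₃ → (S : List A) → Vec F₃ (length S) → List A
  support e []      []       = []
  support e (p ∷ S) (c ∷ cs) with c ≟ e
  ... | yes _ = p ∷ support e S cs
  ... | no _  = support e S cs

  support-All : ∀ {P : A → Set} e {S} cs → All P S → All P (support e S cs)
  support-All e []       []       = []
  support-All e (c ∷ cs) (x ∷ xs) with c ≟ e
  ... | yes _ = x ∷ support-All e cs xs
  ... | no _  = support-All e cs xs

  support-Unique : ∀ e {S} cs → Unique S → Unique (support e S cs)
  support-Unique e []       []       = []
  support-Unique e (c ∷ cs) (x ∷ xs) with c ≟ e
  ... | yes _ = support-All e cs x ∷ support-Unique e cs xs
  ... | no _  = support-Unique e cs xs

  support-disjoint : ∀ {S : List A} cs → Unique S →
    All (λ p → All (p ≢_) (support 2F S cs)) (support 1F S cs)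
  support-disjoint {[]}    []                    []      = []
  support-disjoint {p ∷ S} (zero ∷ cs)           (_ ∷ u) = support-disjoint cs u
  support-disjoint {p ∷ S} (suc zero ∷ cs)       (x ∷ u) = support-All 2F cs x ∷ support-disjoint cs u
  support-disjoint {p ∷ S} (suc (suc zero) ∷ cs) (x ∷ u) =
    All.zipWith (λ (p≢q , q≢) → (p≢q ∘ sym) ∷ q≢) (support-All 1F cs x , support-disjoint cs u)

  support-length : ∀ S cs → length (support 1F S cs) ℕ.+ length (support 2F S cs) ≤ length S
  support-length []      []                     = z≤n
  support-length (p ∷ S) (zero ∷ cs)            = ℕ.m≤n⇒m≤1+n (support-length S cs)
  support-length (p ∷ S) (suc zero ∷ cs)        = s≤s (support-length S cs)
  support-length (p ∷ S) (suc (suc zero) ∷ cs)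
    rewrite ℕ.+-suc (length (support 1F S cs)) (length (support 2F S cs)) =
    s≤s (support-length S cs)

  support-[] : ∀ S cs → support 1F S cs ≡ [] → support 2F S cs ≡ [] → cs ≡ replicate _ 0F
  support-[] []      []                    _   _   = refl
  support-[] (p ∷ S) (zero ∷ cs)           eq₁ eq₂ = cong (0F ∷_) (support-[] S cs eq₁ eq₂)
  support-[] (p ∷ S) (suc zero ∷ cs)       ()
  support-[] (p ∷ S) (suc (suc zero) ∷ cs) _   ()

  card : List A → F₃
  card []      = 0F
  card (_ ∷ S) = 1F +₃ card S

  coeffSum-support : ∀ S cs → coeffSum cs ≡ card (support 1F S cs) +₃ (2F *₃ card (support 2F S cs))
  coeffSum-support []      []                     = refl
  coeffSum-support (p ∷ S) (zero ∷ cs)            = coeffSum-support S cs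
  coeffSum-support (p ∷ S) (suc zero ∷ cs)        =
    trans (cong (1F +₃_) (coeffSum-support S cs)) (sym (+₃-assoc 1F (card (support 1F S cs)) _))
  coeffSum-support (p ∷ S) (suc (suc zero) ∷ cs)  =
    trans (cong (2F +₃_) (coeffSum-support S cs))
      (step (card (support 1F S cs)) (card (support 2F S cs)))
    where
    step : ∀ x y → 2F +₃ (x +₃ (2F *₃ y)) ≡ x +₃ (2F *₃ (1F +₃ y))
    step = toWitness {a? = all? λ x → all? λ y → _ ≟ _} _

total : ∀ {n} → List (Point n) → Point n
total = foldr _+ᵥ_ 0ᵥ

linComb-support : ∀ {n} (S : List (Point n)) cs →
  linComb S cs ≡ total (support 1F S cs) +ᵥ (2F ·ᵥ total (support 2F S cs))
linComb-support []      []          = sym (trans (+ᵥ-identityˡ _) (·ᵥ-0ᵥ 2F))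
linComb-support (p ∷ S) (zero ∷ cs) =
  trans (cong₂ _+ᵥ_ (0·ᵥ p) (linComb-support S cs)) (+ᵥ-identityˡ _)
linComb-support (p ∷ S) (suc zero ∷ cs) =
  trans (cong₂ _+ᵥ_ (1·ᵥ p) (linComb-support S cs)) (sym (+ᵥ-assoc p _ _))
linComb-support (p ∷ S) (suc (suc zero) ∷ cs) = begin
  (2F ·ᵥ p) +ᵥ linComb S cs                  ≡⟨ cong ((2F ·ᵥ p) +ᵥ_) (linComb-support S cs) ⟩
  (2F ·ᵥ p) +ᵥ (P +ᵥ (2F ·ᵥ Q))              ≡⟨ +ᵥ-assoc _ _ _ ⟨
  ((2F ·ᵥ p) +ᵥ P) +ᵥ (2F ·ᵥ Q)              ≡⟨ cong (_+ᵥ (2F ·ᵥ Q)) (+ᵥ-comm (2F ·ᵥ p) P) ⟩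
  (P +ᵥ (2F ·ᵥ p)) +ᵥ (2F ·ᵥ Q)              ≡⟨ +ᵥ-assoc _ _ _ ⟩
  P +ᵥ ((2F ·ᵥ p) +ᵥ (2F ·ᵥ Q))              ≡⟨ cong (P +ᵥ_) (·ᵥ-distribˡ 2F p Q) ⟨
  P +ᵥ (2F ·ᵥ (p +ᵥ Q))                      ∎
  where
  open ≡-Reasoning
  P = total (support 1F S cs)
  Q = total (support 2F S cs)

module _ {n} {C : List (Point n)} (sidon : Sidon C) where

  no-collinear : ∀ {a b c} → a ∈ C → b ∈ C → c ∈ C → a ≢ c → total (a ∷ b ∷ c ∷ []) ≢ 0ᵥ
  no-collinear {a} {b} {c} a∈ b∈ c∈ a≢c eq =
    [ a≢c , a≢c ]′ (sidon a∈ b∈ c∈ c∈ (a+b+c≡0⇒a+b≡c+c a b c eq))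

  -- With at most four points in all and sizes congruent modulo 3, the nonempty possibilities are 3
  -- + 0, 0 + 3, 1 + 1 and 2 + 2. The first two are lines, the third contradicts disjointness, and
  -- the last is the Sidon equation itself.
  no-relation : ∀ P Q → All (_∈ C) P → All (_∈ C) Q → Unique P → Unique Q →
    All (λ p → All (p ≢_) Q) P → length P ℕ.+ length Q ≤ 4 → card P ≡ card Q → total P ≡ total Q →
    P ≡ [] × Q ≡ []
  no-relation []      []      _ _ _ _ _ _ _ _ = refl , refl
  no-relation (a ∷ b ∷ c ∷ []) [] (a∈ ∷ b∈ ∷ c∈ ∷ []) _ ((_ ∷ a≢c ∷ []) ∷ _) _ _ _ _ eq =
    contradiction eq (no-collinear a∈ b∈ c∈ a≢c)
  no-relation [] (a ∷ b ∷ c ∷ []) _ (a∈ ∷ b∈ ∷ c∈ ∷ []) _ ((_ ∷ a≢c ∷ []) ∷ _) _ _ _ eq =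
    contradiction (sym eq) (no-collinear a∈ b∈ c∈ a≢c)
  no-relation (a ∷ []) (b ∷ []) _ _ _ _ ((a≢b ∷ []) ∷ []) _ _ eq =
    contradiction (trans (sym (+ᵥ-identityʳ a)) (trans eq (+ᵥ-identityʳ b))) a≢b
  no-relation (a ∷ b ∷ []) (c ∷ d ∷ []) (a∈ ∷ b∈ ∷ []) (c∈ ∷ d∈ ∷ []) _ _
    ((a≢c ∷ a≢d ∷ []) ∷ _) _ _ eq = contradiction
    (sidon a∈ b∈ c∈ d∈
      (trans (cong (a +ᵥ_) (sym (+ᵥ-identityʳ b))) (trans eq (cong (c +ᵥ_) (+ᵥ-identityʳ d)))))
      [ a≢c , a≢d ]′
  -- From here on the sizes differ modulo 3 or exceed four in total.
  no-relation [] (_ ∷ _ ∷ _ ∷ _ ∷ []) _ _ _ _ _ _ () _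
  no-relation [] (_ ∷ _ ∷ _ ∷ _ ∷ _ ∷ _) _ _ _ _ _ (s≤s (s≤s (s≤s (s≤s ())))) _ _
  no-relation (_ ∷ []) (_ ∷ _ ∷ []) _ _ _ _ _ _ () _
  no-relation (_ ∷ []) (_ ∷ _ ∷ _ ∷ []) _ _ _ _ _ _ () _
  no-relation (_ ∷ []) (_ ∷ _ ∷ _ ∷ _ ∷ _) _ _ _ _ _ (s≤s (s≤s (s≤s (s≤s ())))) _ _
  no-relation (_ ∷ _ ∷ []) (_ ∷ _ ∷ _ ∷ _) _ _ _ _ _ (s≤s (s≤s (s≤s (s≤s ())))) _ _
  no-relation (_ ∷ _ ∷ _ ∷ []) (_ ∷ []) _ _ _ _ _ _ () _
  no-relation (_ ∷ _ ∷ _ ∷ []) (_ ∷ _ ∷ _) _ _ _ _ _ (s≤s (s≤s (s≤s (s≤s ())))) _ _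
  no-relation (_ ∷ _ ∷ _ ∷ _ ∷ []) [] _ _ _ _ _ _ () _
  no-relation (_ ∷ _ ∷ _ ∷ _ ∷ []) (_ ∷ _) _ _ _ _ _ (s≤s (s≤s (s≤s (s≤s ())))) _ _
  no-relation (_ ∷ _ ∷ _ ∷ _ ∷ _ ∷ _) _ _ _ _ _ _ (s≤s (s≤s (s≤s (s≤s ())))) _ _

  sidon⇒cap : Unique C → IsCap 2 n C
  sidon⇒cap unique = unique , λ S S⊆C len cs coeffs linear →
    let S-unique = unique-resp-⊆ S⊆C unique
        S∈C = All-resp-⊆ S⊆C (All.tabulate id)
        P=[] , Q=[] = no-relation (support 1F S cs) (support 2F S cs)
          (support-All 1F cs S∈C) (support-All 2F cs S∈C)
          (support-Unique 1F cs S-unique) (support-Unique 2F cs S-unique)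
          (support-disjoint cs S-unique)
          (ℕ.≤-trans (support-length S cs) len)
          (a-b≡0⇒a≡b₃ _ _ (trans (sym (coeffSum-support S cs)) coeffs))
          (a-b≡0⇒a≡b _ _ (trans (sym (linComb-support S cs)) linear))
    in support-[] S cs P=[] Q=[]
    where
    unique-resp-⊆ : ∀ {S T : List (Point n)} → S ⊆ T → Unique T → Unique S
    unique-resp-⊆ []         []      = []
    unique-resp-⊆ (_ ∷ˢ τ)   (_ ∷ u) = unique-resp-⊆ τ u
    unique-resp-⊆ (refl ∷ τ) (x ∷ u) = All-resp-⊆ τ x ∷ unique-resp-⊆ τ u

-- Graphs of planar maps

module _ {q} (f : Point q → Point q) (planar : Planar f) where

  graphPoint : Point q → Point (q ℕ.+ q)
  graphPoint v = v Vec.++ f v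

  graph : List (Point (q ℕ.+ q))
  graph = map graphPoint (allPoints q)

  length-graph : length graph ≡ 3 ^ q
  length-graph = trans (length-map graphPoint (allPoints q)) (length-allPoints q)

  graph-sidon : Sidon graph
  graph-sidon a∈ b∈ c∈ d∈ eq
    with ∈-map⁻ graphPoint a∈ | ∈-map⁻ graphPoint b∈ | ∈-map⁻ graphPoint c∈ | ∈-map⁻ graphPoint d∈
  ... | x , _ , refl | y , _ , refl | z , _ , refl | w , _ , refl =
    let sum , images = Vec.++-injective (x +ᵥ y) (z +ᵥ w)
          (trans (sym (Vec.zipWith-++ _+₃_ x (f x) y (f y)))
            (trans eq (Vec.zipWith-++ _+₃_ z (f z) w (f w))))
    in Sum.map (cong graphPoint) (cong graphPoint) (planar sum images)

  graph-cap : IsCap 2 (q ℕ.+ q) graph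
  graph-cap = sidon⇒cap graph-sidon
    (Unique.map⁺ (Vec.++-injectiveˡ _ _) (allPoints-unique q))

maxCapSize : ∀ q → IsMaxCapSize 2 (q ℕ.+ q) (3 ^ q)
maxCapSize q =
  let f , planar = planar-exists q
  in (graph f planar , graph-cap f planar , length-graph f planar) , cap-length-≤ q

theorem3p4 : (n : ℕ) → 2 ∣ n → IsMaxCapSize 2 n (3 ^ (n / 2))
theorem3p4 n (divides q refl) = subst (λ k → IsMaxCapSize 2 n (3 ^ k)) (sym (ℕ.m*n/n≡m q 2))
  (subst (λ k → IsMaxCapSize 2 k (3 ^ q)) q+q≡q*2 (maxCapSize q))
  where
  q+q≡q*2 : q ℕ.+ q ≡ q ℕ.* 2
  q+q≡q*2 = trans (cong (q ℕ.+_) (sym (ℕ.+-identityʳ q))) (ℕ.*-comm 2 q)
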